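{- Let $(\mathbb X,\otimes,K)$ be a linear category with monoidal coalgebra modality $(!,\delta,\varepsilon,\Delta,\mathsf e,\mathsf m,\mathsf m_K)$. Then the following are in bijective correspondence: (1) groups in the Cartesian monoidal category $(\mathbb X^!,\otimes^{\mathsf m},(K,\mathsf m_K))$; (2) cocommutative Hopf monoids $(H,\nabla,\mathsf u,\Delta^H,\mathsf e^H,\mathsf S)$ in $(\mathbb X,\otimes,K)$ equipped with a natural transformation $\lambda_X:H\otimes!X\to!(H\otimes X)$ such that $(H\otimes-,\mu^\nabla,\eta^{\mathsf u},\mathsf n^{\Delta^H},\mathsf n^{\mathsf e^H}_K,\lambda)$ is a $\mathsf{MELL}$ lifting monad, and such that $!(\alpha_{H,X,Y})\circ\lambda_{X\otimes Y}\circ(1_H\otimes\mathsf m_{X,Y})=\mathsf m_{H\otimes X,Y}\circ(\lambda_X\otimes1_{!Y})\circ\alpha_{H,!X,!Y}$ for all $X,Y$, and $\lambda_X\circ(\mathsf S\otimes1_{!X})=!(\mathsf S\otimes1_X)\circ\lambda_X$ for all $X$. Consequently, for each group $((H,\omega),\nabla,\mathsf u,\mathsf S)$ in $(\mathbb X^!,\otimes^{\mathsf m},(K,\mathsf m_K))$, the category $\mathsf{MOD}(H,\nabla,\mathsf u)$ of left $(H,\nabla,\mathsf u)$-modules, with the symmetric monoidal structure induced by the comonoid $(H,\Delta^\omega,\mathsf e^\omega)$, is a linear category.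
   Context: Composition is written $g\circ f$; $(\mathbb X,\otimes,K)$ is symmetric monoidal with associator $\alpha_{A,B,C}:A\otimes(B\otimes C)\to(A\otimes B)\otimes C$, unitors $\ell,\rho$, symmetry $\sigma$, and interchange isomorphism $\tau_{A,B,C,D}:(A\otimes B)\otimes(C\otimes D)\to(A\otimes C)\otimes(B\otimes D)$. Symmetric comonoidal monad: a monad $(\mathsf T,\mu,\eta)$ with natural $\mathsf n_{A,B}:\mathsf T(A\otimes B)\to\mathsf TA\otimes\mathsf TB$ and $\mathsf n_K:\mathsf TK\to K$ making $\mathsf T$ symmetric comonoidal, with $\mathsf n_{A,B}\circ\mu_{A\otimes B}=(\mu_A\otimes\mu_B)\circ\mathsf n_{\mathsf TA,\mathsf TB}\circ\mathsf T(\mathsf n_{A,B})$, $\mathsf n_K\circ\mu_K=\mathsf n_K\circ\mathsf T(\mathsf n_K)$, $\mathsf n_{A,B}\circ\eta_{A\otimes B}=\eta_A\otimes\eta_B$, $\mathsf n_K\circ\eta_K=1_K$. It is a symmetric Hopf monad if the fusion operators $(1\otimes\mu_B)\circ\mathsf n_{A,\mathsf TB}$ and $(\mu_A\otimes1)\circ\mathsf n_{\mathsf TA,B}$ are isomorphisms. Symmetric monoidal comonad $(!,\delta,\varepsilon,\mathsf m,\mathsf m_K)$: the dual notion, with lax monoidal $\mathsf m_{A,B}:!A\otimes!B\to!(A\otimes B)$, $\mathsf m_K:K\to!K$ and $\delta,\varepsilon$ monoidal. Its Eilenberg–Moore category of coalgebras $\mathbb X^!$ is symmetric monoidal with $(A,\omega)\otimes^{\mathsf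 m}(B,\omega')=(A\otimes B,\mathsf m_{A,B}\circ(\omega\otimes\omega'))$ and unit $(K,\mathsf m_K)$. Monoidal coalgebra modality: a symmetric monoidal comonad together with natural $\Delta_A:!A\to!A\otimes!A$, $\mathsf e_A:!A\to K$ making each $!A$ a cocommutative comonoid with $\delta_A$ a comonoid morphism, such that $\Delta_{A\otimes B}\circ\mathsf m_{A,B}=(\mathsf m_{A,B}\otimes\mathsf m_{A,B})\circ\tau\circ(\Delta_A\otimes\Delta_B)$, $\mathsf e_{A\otimes B}\circ\mathsf m_{A,B}=\ell_K\circ(\mathsf e_A\otimes\mathsf e_B)$, $\Delta_K\circ\mathsf m_K=(\mathsf m_K\otimes\mathsf m_K)\circ\ell_K^{ -1}$, $\mathsf e_K\circ\mathsf m_K=1_K$, $!(\Delta_A)\circ\delta_A=\mathsf m_{!A,!A}\circ(\delta_A\otimes\delta_A)\circ\Delta_A$, $!(\mathsf e_A)\circ\delta_A=\mathsf m_K\circ\mathsf e_A$. A linear category is a symmetric monoidal closed category with a monoidal coalgebra modality. For a monoidal coalgebra modality, $(\mathbb X^!,\otimes^{\mathsf m},(K,\mathsf m_K))$ is a Cartesian monoidal category in which the (unique) comonoid structure on $(A,\omega)$ is $\Delta^\omega=(\varepsilon_A\otimes\varepsilon_A)\circ\Delta_A\circ\omega$, $\mathsf e^\omega=\mathsf e_A\circ\omega$. A group in it is a monoid $((H,\omega),\nabla,\mathsf u)$ in $\mathbb X^!$ with a morphism $\mathsf S:(H,\omega)\to(H,\omega)$ of $\mathbb X^!$ such that $(H,\nabla,\mathsf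 u,\Delta^\omega,\mathsf e^\omega,\mathsf S)$ is a (cocommutative) Hopf monoid. For a cocommutative bimonoid $(A,\nabla,\mathsf u,\Delta^A,\mathsf e^A)$ in $\mathbb X$, $(A\otimes-,\mu^\nabla,\eta^{\mathsf u},\mathsf n^{\Delta^A},\mathsf n^{\mathsf e^A}_K)$ is the symmetric comonoidal monad with $\mu^\nabla_X=(\nabla\otimes1_X)\circ\alpha_{A,A,X}$, $\eta^{\mathsf u}_X=(\mathsf u\otimes1_X)\circ\ell_X^{ -1}$, $\mathsf n^{\Delta^A}_{X,Y}=\tau_{A,A,X,Y}\circ(\Delta^A\otimes1_{X\otimes Y})$, $\mathsf n^{\mathsf e^A}_K=\mathsf e^A\circ\rho_A$; its algebras are the left $(A,\nabla,\mathsf u)$-modules, forming $\mathsf{MOD}(A,\nabla,\mathsf u)$, with tensor $(M,a)\otimes(N,b)=(M\otimes N,(a\otimes b)\circ\mathsf n^{\Delta^A}_{M,N})$ and unit $(K,\mathsf n^{\mathsf e^A}_K)$. Mixed distributive law of a monad $(\mathsf T,\mu,\eta)$ over comonad $(!,\delta,\varepsilon)$: natural $\lambda_A:\mathsf T!A\to!\mathsf TA$ with $\lambda_A\circ\mu_{!A}=!(\mu_A)\circ\lambda_{\mathsf TA}\circ\mathsf T(\lambda_A)$, $\lambda_A\circ\eta_{!A}=!(\eta_A)$, $\delta_{\mathsf TA}\circ\lambda_A=!(\lambda_A)\circ\lambda_{!A}\circ\mathsf T(\delta_A)$, $\varepsilon_{\mathsf TA}\circ\lambda_A=\mathsf T(\varepsilon_A)$;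 symmetric monoidal if also $!(\mathsf n_{A,B})\circ\lambda_{A\otimes B}\circ\mathsf T(\mathsf m_{A,B})=\mathsf m_{\mathsf TA,\mathsf TB}\circ(\lambda_A\otimes\lambda_B)\circ\mathsf n_{!A,!B}$ and $!(\mathsf n_K)\circ\lambda_K\circ\mathsf T(\mathsf m_K)=\mathsf m_K\circ\mathsf n_K$. A $\mathsf{MELL}$ lifting monad on a linear category is a symmetric comonoidal monad which is a symmetric Hopf monad, together with a symmetric monoidal mixed distributive law of it over the monoidal coalgebra modality. -}

module Defs where

open import Level using (Level; _⊔_) renaming (suc to lsuc)
open import Relation.Binary using (IsEquivalence; Setoid)
open import Data.Product using (Σ; _×_; _,_; proj₁; proj₂)
import Relation.Binary.Reasoning.Setoid as SetoidR

record Category (o c r : Level) : Set (lsuc (o ⊔ c ⊔ r)) where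
  infixr 9 _∘_
  infix  4 _≈_ _⇒_
  field
    Obj : Set o
    _⇒_ : Obj → Obj → Set c
    _≈_ : ∀ {A B} → A ⇒ B → A ⇒ B → Set r
    id  : ∀ {A} → A ⇒ A
    _∘_ : ∀ {A B C} → B ⇒ C → A ⇒ B → A ⇒ C
    equiv : ∀ {A B} → IsEquivalence (_≈_ {A} {B})
    assoc : ∀ {A B C D} {f : A ⇒ B} {g : B ⇒ C} {h : C ⇒ D} →
            (h ∘ g) ∘ f ≈ h ∘ (g ∘ f)
    identityˡ : ∀ {A B} {f : A ⇒ B} → id ∘ f ≈ f
    identityʳ : ∀ {A B} {f : A ⇒ B} → f ∘ id ≈ f
    ∘-resp-≈ : ∀ {A B C} {f h : B ⇒ C} {g i : A ⇒ B} →
               f ≈ h → g ≈ i → f ∘ g ≈ h ∘ i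

  hom-setoid : Obj → Obj → Setoid c r
  hom-setoid A B = record { Carrier = A ⇒ B ; _≈_ = _≈_ ; isEquivalence = equiv }

  module Eq {A B : Obj} = IsEquivalence (equiv {A} {B})

  IsIso : ∀ {A B} → A ⇒ B → Set (c ⊔ r)
  IsIso {A} {B} f = Σ (B ⇒ A) λ g → (g ∘ f ≈ id) × (f ∘ g ≈ id)

record SymmetricMonoidal {o c r} (𝕏 : Category o c r) : Set (o ⊔ c ⊔ r) where
  open Category 𝕏
  infixr 10 _⊗₀_ _⊗₁_
  field
    _⊗₀_ : Obj → Obj → Obj
    _⊗₁_ : ∀ {A B C D} → A ⇒ B → C ⇒ D → A ⊗₀ C ⇒ B ⊗₀ D
    K : Obj
    ⊗-identity : ∀ {A B} → id {A} ⊗₁ id {B} ≈ id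
    ⊗-homomorphism : ∀ {A B C D E F} {f : A ⇒ B} {g : B ⇒ C} {h : D ⇒ E} {k : E ⇒ F} →
                     (g ∘ f) ⊗₁ (k ∘ h) ≈ (g ⊗₁ k) ∘ (f ⊗₁ h)
    ⊗-resp-≈ : ∀ {A B C D} {f g : A ⇒ B} {h k : C ⇒ D} →
               f ≈ g → h ≈ k → f ⊗₁ h ≈ g ⊗₁ k
    α   : ∀ A B C → A ⊗₀ (B ⊗₀ C) ⇒ (A ⊗₀ B) ⊗₀ C
    α⁻¹ : ∀ A B C → (A ⊗₀ B) ⊗₀ C ⇒ A ⊗₀ (B ⊗₀ C)
    α-isoˡ : ∀ {A B C} → α⁻¹ A B C ∘ α A B C ≈ id
    α-isoʳ : ∀ {A B C} → α A B C ∘ α⁻¹ A B C ≈ id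
    α-natural : ∀ {A B C D E F} {f : A ⇒ D} {g : B ⇒ E} {h : C ⇒ F} →
                α D E F ∘ (f ⊗₁ (g ⊗₁ h)) ≈ ((f ⊗₁ g) ⊗₁ h) ∘ α A B C
    ℓ   : ∀ A → K ⊗₀ A ⇒ A
    ℓ⁻¹ : ∀ A → A ⇒ K ⊗₀ A
    ℓ-isoˡ : ∀ {A} → ℓ⁻¹ A ∘ ℓ A ≈ id
    ℓ-isoʳ : ∀ {A} → ℓ A ∘ ℓ⁻¹ A ≈ id
    ℓ-natural : ∀ {A B} {f : A ⇒ B} → ℓ B ∘ (id ⊗₁ f) ≈ f ∘ ℓ A
    ρ   : ∀ A → A ⊗₀ K ⇒ A
    ρ⁻¹ : ∀ A → A ⇒ A ⊗₀ K
    ρ-isoˡ : ∀ {A} → ρ⁻¹ A ∘ ρ A ≈ id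
    ρ-isoʳ : ∀ {A} → ρ A ∘ ρ⁻¹ A ≈ id
    ρ-natural : ∀ {A B} {f : A ⇒ B} → ρ B ∘ (f ⊗₁ id) ≈ f ∘ ρ A
    σ : ∀ A B → A ⊗₀ B ⇒ B ⊗₀ A
    σ-natural : ∀ {A B C D} {f : A ⇒ B} {g : C ⇒ D} →
                σ B D ∘ (f ⊗₁ g) ≈ (g ⊗₁ f) ∘ σ A C
    σ-involutive : ∀ {A B} → σ B A ∘ σ A B ≈ id
    pentagon : ∀ {A B C D} →
               α (A ⊗₀ B) C D ∘ α A B (C ⊗₀ D)
               ≈ (α A B C ⊗₁ id) ∘ (α A (B ⊗₀ C) D ∘ (id ⊗₁ α B C D))
    triangle : ∀ {A B} → (ρ A ⊗₁ id {B}) ∘ α A K B ≈ id {A} ⊗₁ ℓ B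
    hexagon : ∀ {A B C} →
              α⁻¹ B C A ∘ (σ A (B ⊗₀ C) ∘ α⁻¹ A B C)
              ≈ (id ⊗₁ σ A C) ∘ (α⁻¹ B A C ∘ (σ A B ⊗₁ id))

  τ : ∀ A B C D → (A ⊗₀ B) ⊗₀ (C ⊗₀ D) ⇒ (A ⊗₀ C) ⊗₀ (B ⊗₀ D)
  τ A B C D = α A C (B ⊗₀ D) ∘ ((id ⊗₁ α⁻¹ C B D) ∘ ((id ⊗₁ (σ B C ⊗₁ id))
              ∘ ((id ⊗₁ α B C D) ∘ α⁻¹ A B (C ⊗₀ D))))

record Closed {o c r} {𝕏 : Category o c r} (M : SymmetricMonoidal 𝕏) : Set (o ⊔ c ⊔ r) where
  open Category 𝕏
  open SymmetricMonoidal M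
  field
    [_,_] : Obj → Obj → Obj
    ev : ∀ B C → [ B , C ] ⊗₀ B ⇒ C
    curry : ∀ {A B C} → A ⊗₀ B ⇒ C → A ⇒ [ B , C ]
    curry-resp-≈ : ∀ {A B C} {f g : A ⊗₀ B ⇒ C} → f ≈ g → curry f ≈ curry g
    β : ∀ {A B C} {f : A ⊗₀ B ⇒ C} → ev B C ∘ (curry f ⊗₁ id) ≈ f
    η : ∀ {A B C} {g : A ⇒ [ B , C ]} → curry (ev B C ∘ (g ⊗₁ id)) ≈ g

record MonoidalCoalgebraModality {o c r} {𝕏 : Category o c r}
       (M : SymmetricMonoidal 𝕏) : Set (o ⊔ c ⊔ r) where
  open Category 𝕏
  open SymmetricMonoidal M
  field
    !₀ : Obj → Obj
    !₁ : ∀ {A B} → A ⇒ B → !₀ A ⇒ !₀ B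
    !-identity : ∀ {A} → !₁ (id {A}) ≈ id
    !-homomorphism : ∀ {A B C} {f : A ⇒ B} {g : B ⇒ C} → !₁ (g ∘ f) ≈ !₁ g ∘ !₁ f
    !-resp-≈ : ∀ {A B} {f g : A ⇒ B} → f ≈ g → !₁ f ≈ !₁ g
    δ : ∀ A → !₀ A ⇒ !₀ (!₀ A)
    ε : ∀ A → !₀ A ⇒ A
    δ-natural : ∀ {A B} {f : A ⇒ B} → δ B ∘ !₁ f ≈ !₁ (!₁ f) ∘ δ A
    ε-natural : ∀ {A B} {f : A ⇒ B} → ε B ∘ !₁ f ≈ f ∘ ε A
    comonad-assoc : ∀ {A} → !₁ (δ A) ∘ δ A ≈ δ (!₀ A) ∘ δ A
    comonad-idˡ : ∀ {A} → ε (!₀ A) ∘ δ A ≈ id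
    comonad-idʳ : ∀ {A} → !₁ (ε A) ∘ δ A ≈ id
    m : ∀ A B → !₀ A ⊗₀ !₀ B ⇒ !₀ (A ⊗₀ B)
    mK : K ⇒ !₀ K
    m-natural : ∀ {A B C D} {f : A ⇒ B} {g : C ⇒ D} →
                m B D ∘ (!₁ f ⊗₁ !₁ g) ≈ !₁ (f ⊗₁ g) ∘ m A C
    m-assoc : ∀ {A B C} →
              m (A ⊗₀ B) C ∘ ((m A B ⊗₁ id) ∘ α (!₀ A) (!₀ B) (!₀ C))
              ≈ !₁ (α A B C) ∘ (m A (B ⊗₀ C) ∘ (id ⊗₁ m B C))
    m-unitˡ : ∀ {A} → !₁ (ℓ A) ∘ (m K A ∘ (mK ⊗₁ id)) ≈ ℓ (!₀ A)
    m-unitʳ : ∀ {A} → !₁ (ρ A) ∘ (m A K ∘ (id ⊗₁ mK)) ≈ ρ (!₀ A)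
    m-symmetric : ∀ {A B} → m B A ∘ σ (!₀ A) (!₀ B) ≈ !₁ (σ A B) ∘ m A B
    δ-monoidal : ∀ {A B} → δ (A ⊗₀ B) ∘ m A B ≈ !₁ (m A B) ∘ (m (!₀ A) (!₀ B) ∘ (δ A ⊗₁ δ B))
    δ-monoidalK : δ K ∘ mK ≈ !₁ mK ∘ mK
    ε-monoidal : ∀ {A B} → ε (A ⊗₀ B) ∘ m A B ≈ ε A ⊗₁ ε B
    ε-monoidalK : ε K ∘ mK ≈ id
    Δ : ∀ A → !₀ A ⇒ !₀ A ⊗₀ !₀ A
    e : ∀ A → !₀ A ⇒ K
    Δ-natural : ∀ {A B} {f : A ⇒ B} → Δ B ∘ !₁ f ≈ (!₁ f ⊗₁ !₁ f) ∘ Δ A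
    e-natural : ∀ {A B} {f : A ⇒ B} → e B ∘ !₁ f ≈ e A
    Δ-coassoc : ∀ {A} → α (!₀ A) (!₀ A) (!₀ A) ∘ ((id ⊗₁ Δ A) ∘ Δ A) ≈ (Δ A ⊗₁ id) ∘ Δ A
    Δ-counitˡ : ∀ {A} → ℓ (!₀ A) ∘ ((e A ⊗₁ id) ∘ Δ A) ≈ id
    Δ-counitʳ : ∀ {A} → ρ (!₀ A) ∘ ((id ⊗₁ e A) ∘ Δ A) ≈ id
    Δ-cocomm : ∀ {A} → σ (!₀ A) (!₀ A) ∘ Δ A ≈ Δ A
    δ-comonoid-Δ : ∀ {A} → Δ (!₀ A) ∘ δ A ≈ (δ A ⊗₁ δ A) ∘ Δ A
    δ-comonoid-e : ∀ {A} → e (!₀ A) ∘ δ A ≈ e A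
    Δ-m : ∀ {A B} → Δ (A ⊗₀ B) ∘ m A B
          ≈ (m A B ⊗₁ m A B) ∘ (τ (!₀ A) (!₀ A) (!₀ B) (!₀ B) ∘ (Δ A ⊗₁ Δ B))
    e-m : ∀ {A B} → e (A ⊗₀ B) ∘ m A B ≈ ℓ K ∘ (e A ⊗₁ e B)
    Δ-mK : Δ K ∘ mK ≈ (mK ⊗₁ mK) ∘ ℓ⁻¹ K
    e-mK : e K ∘ mK ≈ id
    !Δ-δ : ∀ {A} → !₁ (Δ A) ∘ δ A ≈ m (!₀ A) (!₀ A) ∘ ((δ A ⊗₁ δ A) ∘ Δ A)
    !e-δ : ∀ {A} → !₁ (e A) ∘ δ A ≈ mK ∘ e A

record LinearStructure {o c r} {𝕏 : Category o c r}
       (M : SymmetricMonoidal 𝕏) : Set (o ⊔ c ⊔ r) where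
  field
    closed : Closed M
    modality : MonoidalCoalgebraModality M

module MonoidalNotions {o c r} {𝕏 : Category o c r} (M : SymmetricMonoidal 𝕏) where
  open Category 𝕏
  open SymmetricMonoidal M

  record IsMonoidObj (H : Obj) (∇ : H ⊗₀ H ⇒ H) (u : K ⇒ H) : Set r where
    field
      ∇-assoc : ∇ ∘ (id ⊗₁ ∇) ≈ ∇ ∘ ((∇ ⊗₁ id) ∘ α H H H)
      ∇-unitˡ : ∇ ∘ ((u ⊗₁ id) ∘ ℓ⁻¹ H) ≈ id
      ∇-unitʳ : ∇ ∘ ((id ⊗₁ u) ∘ ρ⁻¹ H) ≈ id

  record IsComonoidObj (H : Obj) (Δ : H ⇒ H ⊗₀ H) (ϵ : H ⇒ K) : Set r where
    field
      Δ-coassoc : α H H H ∘ ((id ⊗₁ Δ) ∘ Δ) ≈ (Δ ⊗₁ id) ∘ Δ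
      Δ-counitˡ : ℓ H ∘ ((ϵ ⊗₁ id) ∘ Δ) ≈ id
      Δ-counitʳ : ρ H ∘ ((id ⊗₁ ϵ) ∘ Δ) ≈ id

  record IsBimonoid (H : Obj) (∇ : H ⊗₀ H ⇒ H) (u : K ⇒ H)
                    (Δ : H ⇒ H ⊗₀ H) (ϵ : H ⇒ K) : Set r where
    field
      isMonoid : IsMonoidObj H ∇ u
      isComonoid : IsComonoidObj H Δ ϵ
      Δ-∇ : Δ ∘ ∇ ≈ (∇ ⊗₁ ∇) ∘ (τ H H H H ∘ (Δ ⊗₁ Δ))
      ϵ-∇ : ϵ ∘ ∇ ≈ ℓ K ∘ (ϵ ⊗₁ ϵ)
      Δ-u : Δ ∘ u ≈ (u ⊗₁ u) ∘ ℓ⁻¹ K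
      ϵ-u : ϵ ∘ u ≈ id

  record IsHopfMonoid (H : Obj) (∇ : H ⊗₀ H ⇒ H) (u : K ⇒ H)
                      (Δ : H ⇒ H ⊗₀ H) (ϵ : H ⇒ K) (S : H ⇒ H) : Set r where
    field
      isBimonoid : IsBimonoid H ∇ u Δ ϵ
      antipodeˡ : ∇ ∘ ((S ⊗₁ id) ∘ Δ) ≈ u ∘ ϵ
      antipodeʳ : ∇ ∘ ((id ⊗₁ S) ∘ Δ) ≈ u ∘ ϵ

  IsCocommutative : (H : Obj) → (Δ : H ⇒ H ⊗₀ H) → Set r
  IsCocommutative H Δ = σ H H ∘ Δ ≈ Δ

  record IsCocommutativeHopfMonoid (H : Obj) (∇ : H ⊗₀ H ⇒ H) (u : K ⇒ H)
                      (Δ : H ⇒ H ⊗₀ H) (ϵ : H ⇒ K) (S : H ⇒ H) : Set r where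
    field
      isHopfMonoid : IsHopfMonoid H ∇ u Δ ϵ S
      cocommutative : IsCocommutative H Δ

module OverModality {o c r} {𝕏 : Category o c r} {M : SymmetricMonoidal 𝕏}
                    (L : MonoidalCoalgebraModality M) where
  open Category 𝕏
  open SymmetricMonoidal M
  open MonoidalCoalgebraModality L
  open MonoidalNotions M

  -- Groups in the Cartesian monoidal category (𝕏^!, ⊗^m, (K, mK)),
  -- unfolded into data of 𝕏.

  Δ^ : ∀ {A} → A ⇒ !₀ A → A ⇒ A ⊗₀ A
  Δ^ {A} ω = (ε A ⊗₁ ε A) ∘ (Δ A ∘ ω)

  e^ : ∀ {A} → A ⇒ !₀ A → A ⇒ K
  e^ {A} ω = e A ∘ ω

  record IsCoalgebra (A : Obj) (ω : A ⇒ !₀ A) : Set r where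
    field
      coalg-δ : δ A ∘ ω ≈ !₁ ω ∘ ω
      coalg-ε : ε A ∘ ω ≈ id

  -- ((H, ω), ∇, u) is a monoid in 𝕏^! and S : (H, ω) → (H, ω) in 𝕏^!
  -- makes (H, ∇, u, Δ^ω, e^ω, S) a Hopf monoid.
  record IsGroupInCoalgebras (H : Obj) (∇ : H ⊗₀ H ⇒ H) (u : K ⇒ H)
                             (S : H ⇒ H) (ω : H ⇒ !₀ H) : Set r where
    field
      coalgebra : IsCoalgebra H ω
      ∇-coalgebra-map : ω ∘ ∇ ≈ !₁ ∇ ∘ (m H H ∘ (ω ⊗₁ ω))
      u-coalgebra-map : ω ∘ u ≈ !₁ u ∘ mK
      S-coalgebra-map : ω ∘ S ≈ !₁ S ∘ ω
      monoid : IsMonoidObj H ∇ u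
      hopf : IsHopfMonoid H ∇ u (Δ^ ω) (e^ ω) S

  GroupStructures : (H : Obj) (∇ : H ⊗₀ H ⇒ H) (u : K ⇒ H) (S : H ⇒ H) → Setoid (c ⊔ r) r
  GroupStructures H ∇ u S = record
    { Carrier = Σ (H ⇒ !₀ H) (IsGroupInCoalgebras H ∇ u S)
    ; _≈_ = λ x y → proj₁ x ≈ proj₁ y
    ; isEquivalence = record
      { refl = Eq.refl ; sym = Eq.sym ; trans = Eq.trans } }

  record MonadData : Set (o ⊔ c) where
    field
      T₀ : Obj → Obj
      T₁ : ∀ {A B} → A ⇒ B → T₀ A ⇒ T₀ B
      μ : ∀ A → T₀ (T₀ A) ⇒ T₀ A
      η : ∀ A → A ⇒ T₀ A
      n : ∀ A B → T₀ (A ⊗₀ B) ⇒ T₀ A ⊗₀ T₀ B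
      nK : T₀ K ⇒ K

  module _ (T : MonadData) where
    open MonadData T

    record IsMonad : Set (o ⊔ c ⊔ r) where
      field
        T-identity : ∀ {A} → T₁ (id {A}) ≈ id
        T-homomorphism : ∀ {A B C} {f : A ⇒ B} {g : B ⇒ C} → T₁ (g ∘ f) ≈ T₁ g ∘ T₁ f
        T-resp-≈ : ∀ {A B} {f g : A ⇒ B} → f ≈ g → T₁ f ≈ T₁ g
        μ-natural : ∀ {A B} {f : A ⇒ B} → μ B ∘ T₁ (T₁ f) ≈ T₁ f ∘ μ A
        η-natural : ∀ {A B} {f : A ⇒ B} → η B ∘ f ≈ T₁ f ∘ η A
        monad-assoc : ∀ {A} → μ A ∘ T₁ (μ A) ≈ μ A ∘ μ (T₀ A)
        monad-idˡ : ∀ {A} → μ A ∘ η (T₀ A) ≈ id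
        monad-idʳ : ∀ {A} → μ A ∘ T₁ (η A) ≈ id

    record IsSymmetricComonoidalMonad : Set (o ⊔ c ⊔ r) where
      field
        isMonad : IsMonad
        n-natural : ∀ {A B C D} {f : A ⇒ B} {g : C ⇒ D} →
                    n B D ∘ T₁ (f ⊗₁ g) ≈ (T₁ f ⊗₁ T₁ g) ∘ n A C
        n-assoc : ∀ {A B C} →
                  α (T₀ A) (T₀ B) (T₀ C) ∘ ((id ⊗₁ n B C) ∘ n A (B ⊗₀ C))
                  ≈ (n A B ⊗₁ id) ∘ (n (A ⊗₀ B) C ∘ T₁ (α A B C))
        n-unitˡ : ∀ {A} → ℓ (T₀ A) ∘ ((nK ⊗₁ id) ∘ n K A) ≈ T₁ (ℓ A)
        n-unitʳ : ∀ {A} → ρ (T₀ A) ∘ ((id ⊗₁ nK) ∘ n A K) ≈ T₁ (ρ A)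
        n-symmetric : ∀ {A B} → σ (T₀ A) (T₀ B) ∘ n A B ≈ n B A ∘ T₁ (σ A B)
        μ-comonoidal : ∀ {A B} → n A B ∘ μ (A ⊗₀ B)
                       ≈ (μ A ⊗₁ μ B) ∘ (n (T₀ A) (T₀ B) ∘ T₁ (n A B))
        μ-comonoidalK : nK ∘ μ K ≈ nK ∘ T₁ nK
        η-comonoidal : ∀ {A B} → n A B ∘ η (A ⊗₀ B) ≈ η A ⊗₁ η B
        η-comonoidalK : nK ∘ η K ≈ id

    record IsSymmetricHopfMonad : Set (o ⊔ c ⊔ r) where
      field
        isSymComonoidalMonad : IsSymmetricComonoidalMonad
        fusionˡ-iso : ∀ {A B} → IsIso ((id ⊗₁ μ B) ∘ n A (T₀ B))
        fusionʳ-iso : ∀ {A B} → IsIso ((μ A ⊗₁ id) ∘ n (T₀ A) B)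

    record IsSymMonoidalMixedDistributiveLaw (ld : ∀ A → T₀ (!₀ A) ⇒ !₀ (T₀ A))
           : Set (o ⊔ c ⊔ r) where
      field
        ld-natural : ∀ {A B} {f : A ⇒ B} → ld B ∘ T₁ (!₁ f) ≈ !₁ (T₁ f) ∘ ld A
        ld-μ : ∀ {A} → ld A ∘ μ (!₀ A) ≈ !₁ (μ A) ∘ (ld (T₀ A) ∘ T₁ (ld A))
        ld-η : ∀ {A} → ld A ∘ η (!₀ A) ≈ !₁ (η A)
        ld-δ : ∀ {A} → δ (T₀ A) ∘ ld A ≈ !₁ (ld A) ∘ (ld (!₀ A) ∘ T₁ (δ A))
        ld-ε : ∀ {A} → ε (T₀ A) ∘ ld A ≈ T₁ (ε A)
        ld-m : ∀ {A B} → !₁ (n A B) ∘ (ld (A ⊗₀ B) ∘ T₁ (m A B))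
               ≈ m (T₀ A) (T₀ B) ∘ ((ld A ⊗₁ ld B) ∘ n (!₀ A) (!₀ B))
        ld-mK : !₁ nK ∘ (ld K ∘ T₁ mK) ≈ mK ∘ nK

    record IsMELLLiftingMonad (ld : ∀ A → T₀ (!₀ A) ⇒ !₀ (T₀ A)) : Set (o ⊔ c ⊔ r) where
      field
        isHopfMonad : IsSymmetricHopfMonad
        isDistributiveLaw : IsSymMonoidalMixedDistributiveLaw ld

  tensorMonad : (H : Obj) (∇ : H ⊗₀ H ⇒ H) (u : K ⇒ H)
                (Δ : H ⇒ H ⊗₀ H) (ϵ : H ⇒ K) → MonadData
  tensorMonad H ∇ u Δ ϵ = record
    { T₀ = λ X → H ⊗₀ X
    ; T₁ = λ f → id ⊗₁ f
    ; μ = λ X → (∇ ⊗₁ id) ∘ α H H X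
    ; η = λ X → (u ⊗₁ id) ∘ ℓ⁻¹ X
    ; n = λ X Y → τ H H X Y ∘ (Δ ⊗₁ id)
    ; nK = ϵ ∘ ρ H
    }

  record HopfLiftingStructure (H : Obj) (∇ : H ⊗₀ H ⇒ H) (u : K ⇒ H) (S : H ⇒ H)
         : Set (o ⊔ c ⊔ r) where
    field
      ΔH : H ⇒ H ⊗₀ H
      eH : H ⇒ K
      ld : ∀ X → H ⊗₀ !₀ X ⇒ !₀ (H ⊗₀ X)
      cocommHopf : IsCocommutativeHopfMonoid H ∇ u ΔH eH S
      mellLifting : IsMELLLiftingMonad (tensorMonad H ∇ u ΔH eH) ld
      ld-α : ∀ {X Y} → !₁ (α H X Y) ∘ (ld (X ⊗₀ Y) ∘ (id ⊗₁ m X Y))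
             ≈ m (H ⊗₀ X) Y ∘ ((ld X ⊗₁ id) ∘ α H (!₀ X) (!₀ Y))
      ld-S : ∀ {X} → ld X ∘ (S ⊗₁ id) ≈ !₁ (S ⊗₁ id) ∘ ld X

  HopfLiftingStructures : (H : Obj) (∇ : H ⊗₀ H ⇒ H) (u : K ⇒ H) (S : H ⇒ H)
                          → Setoid (o ⊔ c ⊔ r) (o ⊔ r)
  HopfLiftingStructures H ∇ u S = record
    { Carrier = HopfLiftingStructure H ∇ u S
    ; _≈_ = λ x y → (ΔH x ≈ ΔH y) × (eH x ≈ eH y) × (∀ X → ld x X ≈ ld y X)
    ; isEquivalence = record
      { refl = Eq.refl , Eq.refl , (λ X → Eq.refl)
      ; sym = λ (p , q , r) → Eq.sym p , Eq.sym q , (λ X → Eq.sym (r X))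
      ; trans = λ (p , q , r) (p' , q' , r') →
          Eq.trans p p' , Eq.trans q q' , (λ X → Eq.trans (r X) (r' X)) } }
    where open HopfLiftingStructure

module Modules {o c r} {𝕏 : Category o c r} (M : SymmetricMonoidal 𝕏)
               (H : Category.Obj 𝕏)
               (∇ : Category._⇒_ 𝕏 (SymmetricMonoidal._⊗₀_ M H H) H)
               (u : Category._⇒_ 𝕏 (SymmetricMonoidal.K M) H) where
  open Category 𝕏
  open SymmetricMonoidal M

  record IsModule (A : Obj) (a : H ⊗₀ A ⇒ A) : Set r where
    field
      act-assoc : a ∘ ((∇ ⊗₁ id) ∘ α H H A) ≈ a ∘ (id ⊗₁ a)
      act-unit : a ∘ ((u ⊗₁ id) ∘ ℓ⁻¹ A) ≈ id

  record Module : Set (o ⊔ c ⊔ r) where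
    constructor module[_,_,_]
    field
      carrier : Obj
      act : H ⊗₀ carrier ⇒ carrier
      isModule : IsModule carrier act
  open Module public

  IsEquivariant : (A B : Module) → carrier A ⇒ carrier B → Set r
  IsEquivariant A B f = f ∘ act A ≈ act B ∘ (id ⊗₁ f)

  record ModuleMap (A B : Module) : Set (c ⊔ r) where
    constructor map[_,_]
    field
      map : carrier A ⇒ carrier B
      equivariant : IsEquivariant A B map
  open ModuleMap public

  private
    id-eq : ∀ {A} → IsEquivariant A A id
    id-eq {A} = begin
        id ∘ act A          ≈⟨ identityˡ ⟩
        act A               ≈⟨ Eq.sym identityʳ ⟩
        act A ∘ id          ≈⟨ ∘-resp-≈ Eq.refl (Eq.sym ⊗-identity) ⟩
        act A ∘ (id ⊗₁ id)  ∎
      where open SetoidR (hom-setoid _ _)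

    ∘-eq : ∀ {A B C} (g : ModuleMap B C) (f : ModuleMap A B) →
           IsEquivariant A C (map g ∘ map f)
    ∘-eq {A} {B} {C} g f = begin
        (map g ∘ map f) ∘ act A                 ≈⟨ assoc ⟩
        map g ∘ (map f ∘ act A)                 ≈⟨ ∘-resp-≈ Eq.refl (equivariant f) ⟩
        map g ∘ (act B ∘ (id ⊗₁ map f))         ≈⟨ Eq.sym assoc ⟩
        (map g ∘ act B) ∘ (id ⊗₁ map f)         ≈⟨ ∘-resp-≈ (equivariant g) Eq.refl ⟩
        (act C ∘ (id ⊗₁ map g)) ∘ (id ⊗₁ map f) ≈⟨ assoc ⟩
        act C ∘ ((id ⊗₁ map g) ∘ (id ⊗₁ map f)) ≈⟨ ∘-resp-≈ Eq.refl (Eq.sym ⊗-homomorphism) ⟩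
        act C ∘ ((id ∘ id) ⊗₁ (map g ∘ map f))  ≈⟨ ∘-resp-≈ Eq.refl (⊗-resp-≈ identityˡ Eq.refl) ⟩
        act C ∘ (id ⊗₁ (map g ∘ map f))         ∎
      where open SetoidR (hom-setoid _ _)

  MOD : Category (o ⊔ c ⊔ r) (c ⊔ r) r
  MOD = record
    { Obj = Module
    ; _⇒_ = ModuleMap
    ; _≈_ = λ f g → map f ≈ map g
    ; id = λ {A} → map[ id , id-eq {A} ]
    ; _∘_ = λ g f → map[ map g ∘ map f , ∘-eq g f ]
    ; equiv = record { refl = Eq.refl ; sym = Eq.sym ; trans = Eq.trans }
    ; assoc = assoc
    ; identityˡ = identityˡ
    ; identityʳ = identityʳ
    ; ∘-resp-≈ = ∘-resp-≈
    }

  -- The symmetric monoidal structure on MOD(H, ∇, u) induced by a comonoid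
  -- (Δ, ϵ) on H: (M, a) ⊗ (N, b) = (M ⊗ N, (a ⊗ b) ∘ n^Δ), unit (K, ϵ ∘ ρ H),
  -- with the structure maps α, ℓ, ρ, σ (and tensor of maps) of 𝕏.
  -- We record, as propositions, the facts that these data are modules and
  -- module maps; from them the monoidal category is assembled.
  module Induced (Δ : H ⇒ H ⊗₀ H) (ϵ : H ⇒ K) where

    nΔ : ∀ A B → H ⊗₀ (A ⊗₀ B) ⇒ (H ⊗₀ A) ⊗₀ (H ⊗₀ B)
    nΔ A B = τ H H A B ∘ (Δ ⊗₁ id)

    tensorAct : (A B : Module) → H ⊗₀ (carrier A ⊗₀ carrier B) ⇒ carrier A ⊗₀ carrier B
    tensorAct A B = (act A ⊗₁ act B) ∘ nΔ (carrier A) (carrier B)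

    unitAct : H ⊗₀ K ⇒ K
    unitAct = ϵ ∘ ρ H

    record TensorObjects : Set (o ⊔ c ⊔ r) where
      field
        tensor-isModule : ∀ A B → IsModule (carrier A ⊗₀ carrier B) (tensorAct A B)
        unit-isModule : IsModule K unitAct

      _⊠_ : Module → Module → Module
      A ⊠ B = module[ carrier A ⊗₀ carrier B , tensorAct A B , tensor-isModule A B ]

      Kₘ : Module
      Kₘ = module[ K , unitAct , unit-isModule ]

    record TensorMaps (T : TensorObjects) : Set (o ⊔ c ⊔ r) where
      open TensorObjects T
      field
        ⊗₁-equivariant : ∀ {A B C D} (f : ModuleMap A B) (g : ModuleMap C D) →
                         IsEquivariant (A ⊠ C) (B ⊠ D) (map f ⊗₁ map g)
        α-equivariant : ∀ A B C → IsEquivariant (A ⊠ (B ⊠ C)) ((A ⊠ B) ⊠ C)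
                                                (α (carrier A) (carrier B) (carrier C))
        α⁻¹-equivariant : ∀ A B C → IsEquivariant ((A ⊠ B) ⊠ C) (A ⊠ (B ⊠ C))
                                                  (α⁻¹ (carrier A) (carrier B) (carrier C))
        ℓ-equivariant : ∀ A → IsEquivariant (Kₘ ⊠ A) A (ℓ (carrier A))
        ℓ⁻¹-equivariant : ∀ A → IsEquivariant A (Kₘ ⊠ A) (ℓ⁻¹ (carrier A))
        ρ-equivariant : ∀ A → IsEquivariant (A ⊠ Kₘ) A (ρ (carrier A))
        ρ⁻¹-equivariant : ∀ A → IsEquivariant A (A ⊠ Kₘ) (ρ⁻¹ (carrier A))
        σ-equivariant : ∀ A B → IsEquivariant (A ⊠ B) (B ⊠ A)
                                              (σ (carrier A) (carrier B))

    InducedMonoidalStructure : Set (o ⊔ c ⊔ r)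
    InducedMonoidalStructure = Σ TensorObjects TensorMaps

    MOD-SMC : InducedMonoidalStructure → SymmetricMonoidal MOD
    MOD-SMC (T , P) = record
      { _⊗₀_ = _⊠_
      ; _⊗₁_ = λ f g → map[ map f ⊗₁ map g , ⊗₁-equivariant f g ]
      ; K = Kₘ
      ; ⊗-identity = ⊗-identity
      ; ⊗-homomorphism = ⊗-homomorphism
      ; ⊗-resp-≈ = ⊗-resp-≈
      ; α = λ A B C → map[ _ , α-equivariant A B C ]
      ; α⁻¹ = λ A B C → map[ _ , α⁻¹-equivariant A B C ]
      ; α-isoˡ = α-isoˡ
      ; α-isoʳ = α-isoʳ
      ; α-natural = α-natural
      ; ℓ = λ A → map[ _ , ℓ-equivariant A ]
      ; ℓ⁻¹ = λ A → map[ _ , ℓ⁻¹-equivariant A ]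
      ; ℓ-isoˡ = ℓ-isoˡ
      ; ℓ-isoʳ = ℓ-isoʳ
      ; ℓ-natural = ℓ-natural
      ; ρ = λ A → map[ _ , ρ-equivariant A ]
      ; ρ⁻¹ = λ A → map[ _ , ρ⁻¹-equivariant A ]
      ; ρ-isoˡ = ρ-isoˡ
      ; ρ-isoʳ = ρ-isoʳ
      ; ρ-natural = ρ-natural
      ; σ = λ A B → map[ _ , σ-equivariant A B ]
      ; σ-natural = σ-natural
      ; σ-involutive = σ-involutive
      ; pentagon = pentagon
      ; triangle = triangle
      ; hexagon = hexagon
      }
      where open TensorObjects T
            open TensorMaps P

{-# OPTIONS --safe #-}
-- A coalgebra structure ω on H yields the distributive law λ_X = m ∘ (ω ⊗ 1), and ω is recovered
-- from λ at the unit, as !ρ ∘ λ_K ∘ (1 ⊗ m_K) ∘ ρ⁻¹; the compatibility of λ with α makes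
-- λ determined by λ_K.  The comonoid structure need not be recorded with ω: for a
-- distributive law compatible with n, the maps Δ^H and e^H are coalgebra morphisms, and a comonoid
-- structure made of coalgebra morphisms is unique.
--
-- That modules form a linear category holds for the algebras of any symmetric Hopf monad T with a
-- distributive law.  The action on [A , B] is the unique one making evaluation a module map; it
-- exists, and is associative, because the fusion map T(X ⊗ A) → TX ⊗ A of a T-algebra A is
-- invertible, so that no formula for the antipode of a product is needed.
module Submission where

open import Defs
open import Data.Product using (Σ; _×_; _,_; proj₁; proj₂)
open import Relation.Binary using (Setoid)
open import Function.Bundles using (Inverse)

-- Equational reasoning in a category.

module Chasing {o c r} (𝕏 : Category o c r) where
  open Category 𝕏

  infixr 5 _○_
  infixr 6 _⟩∘⟨_ refl⟩∘⟨_
  infixl 7 _⟩∘⟨refl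

  _○_ : ∀ {A B} {f g h : A ⇒ B} → f ≈ g → g ≈ h → f ≈ h
  _○_ = Eq.trans

  ⟺ : ∀ {A B} {f g : A ⇒ B} → f ≈ g → g ≈ f
  ⟺ = Eq.sym

  _⟩∘⟨_ : ∀ {A B C} {f h : B ⇒ C} {g i : A ⇒ B} → f ≈ h → g ≈ i → f ∘ g ≈ h ∘ i
  _⟩∘⟨_ = ∘-resp-≈

  refl⟩∘⟨_ : ∀ {A B C} {f : B ⇒ C} {g i : A ⇒ B} → g ≈ i → f ∘ g ≈ f ∘ i
  refl⟩∘⟨_ = ∘-resp-≈ Eq.refl

  _⟩∘⟨refl : ∀ {A B C} {f h : B ⇒ C} {g : A ⇒ B} → f ≈ h → f ∘ g ≈ h ∘ g
  p ⟩∘⟨refl = ∘-resp-≈ p Eq.refl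

  pullˡ : ∀ {A B C D} {a : C ⇒ D} {b : B ⇒ C} {c : B ⇒ D} {f : A ⇒ B} →
          a ∘ b ≈ c → a ∘ (b ∘ f) ≈ c ∘ f
  pullˡ p = ⟺ assoc ○ p ⟩∘⟨refl

  pushˡ : ∀ {A B C D} {a : C ⇒ D} {b : B ⇒ C} {c : B ⇒ D} {f : A ⇒ B} →
          c ≈ a ∘ b → c ∘ f ≈ a ∘ (b ∘ f)
  pushˡ p = p ⟩∘⟨refl ○ assoc

  extendʳ : ∀ {A B C C′ D} {f : C ⇒ D} {g : B ⇒ C} {h : C′ ⇒ D} {i : B ⇒ C′} {k : A ⇒ B} →
            f ∘ g ≈ h ∘ i → f ∘ (g ∘ k) ≈ h ∘ (i ∘ k)
  extendʳ p = pullˡ p ○ assoc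

  cancelˡ : ∀ {A B C} {f : B ⇒ C} {g : C ⇒ B} {k : A ⇒ C} → f ∘ g ≈ id → f ∘ (g ∘ k) ≈ k
  cancelˡ p = pullˡ p ○ identityˡ

  elimˡ : ∀ {A B} {f : B ⇒ B} {g : A ⇒ B} → f ≈ id → f ∘ g ≈ g
  elimˡ p = p ⟩∘⟨refl ○ identityˡ

  elimʳ : ∀ {A B} {f : A ⇒ B} {g : A ⇒ A} → g ≈ id → f ∘ g ≈ f
  elimʳ p = refl⟩∘⟨ p ○ identityʳ

  id-comm : ∀ {A B} {f : A ⇒ B} → id ∘ f ≈ f ∘ id
  id-comm = identityˡ ○ ⟺ identityʳ

  cancel-epi : ∀ {A B C} {f g : B ⇒ C} (h : A ⇒ B) (k : B ⇒ A) → h ∘ k ≈ id → f ∘ h ≈ g ∘ h → f ≈ g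
  cancel-epi h k p q = ⟺ (elimʳ p) ○ ⟺ assoc ○ q ⟩∘⟨refl ○ assoc ○ elimʳ p

  cancel-mono : ∀ {A B C} {f g : A ⇒ B} (h : B ⇒ C) (k : C ⇒ B) → k ∘ h ≈ id → h ∘ f ≈ h ∘ g → f ≈ g
  cancel-mono h k p q = ⟺ (cancelˡ p) ○ refl⟩∘⟨ q ○ cancelˡ p

  -- Inverts two opposite sides of a commuting square; a right inverse of `f` and a left inverse of
  -- `h` suffice. Naturality of `α⁻¹`, `ℓ⁻¹` and `ρ⁻¹` comes from it.
  flip-square : ∀ {A B C D} {f : A ⇒ B} {g : B ⇒ D} {k : A ⇒ C} {h : C ⇒ D} {f⁻¹ : B ⇒ A} {h⁻¹ : D ⇒ C} →
                f ∘ f⁻¹ ≈ id → h⁻¹ ∘ h ≈ id → g ∘ f ≈ h ∘ k → h⁻¹ ∘ g ≈ k ∘ f⁻¹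
  flip-square p q s =
    refl⟩∘⟨ ⟺ (elimʳ p) ○ refl⟩∘⟨ extendʳ s ○ cancelˡ q

  iso-∘ : ∀ {A B C} {g : B ⇒ C} {f : A ⇒ B} → IsIso g → IsIso f → IsIso (g ∘ f)
  iso-∘ (g′ , p , q) (f′ , p′ , q′) =
    f′ ∘ g′ , assoc ○ refl⟩∘⟨ cancelˡ p ○ p′ , assoc ○ refl⟩∘⟨ cancelˡ q′ ○ q

  iso-resp-≈ : ∀ {A B} {f g : A ⇒ B} → f ≈ g → IsIso f → IsIso g
  iso-resp-≈ e (f′ , p , q) = f′ , refl⟩∘⟨ ⟺ e ○ p , ⟺ e ⟩∘⟨refl ○ q

-- Coherence in symmetric monoidal categories.

module Coherence {o c r} {𝕏 : Category o c r} (M : SymmetricMonoidal 𝕏) where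
  open Category 𝕏
  open SymmetricMonoidal M
  open Chasing 𝕏

  infixr 8 _⟩⊗⟨_

  _⟩⊗⟨_ : ∀ {A B C D} {f g : A ⇒ B} {h k : C ⇒ D} → f ≈ g → h ≈ k → f ⊗₁ h ≈ g ⊗₁ k
  _⟩⊗⟨_ = ⊗-resp-≈

  glue : ∀ {A B C A′ B′ C′} {f : B ⇒ C} {g : A ⇒ B} {h : A ⇒ C}
           {f′ : B′ ⇒ C′} {g′ : A′ ⇒ B′} {h′ : A′ ⇒ C′} →
         f ∘ g ≈ h → f′ ∘ g′ ≈ h′ → (f ⊗₁ f′) ∘ (g ⊗₁ g′) ≈ h ⊗₁ h′
  glue p q = ⟺ ⊗-homomorphism ○ p ⟩⊗⟨ q

  glue-squares : ∀ {A B C D A′ B′ C′ D′} {f : B ⇒ D} {g : A ⇒ B} {h : C ⇒ D} {k : A ⇒ C}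
           {f′ : B′ ⇒ D′} {g′ : A′ ⇒ B′} {h′ : C′ ⇒ D′} {k′ : A′ ⇒ C′} →
         f ∘ g ≈ h ∘ k → f′ ∘ g′ ≈ h′ ∘ k′ → (f ⊗₁ f′) ∘ (g ⊗₁ g′) ≈ (h ⊗₁ h′) ∘ (k ⊗₁ k′)
  glue-squares p q = glue p q ○ ⊗-homomorphism

  glue₁ : ∀ {A B C D} {f : B ⇒ C} {g : A ⇒ B} {h : A ⇒ C} →
          f ∘ g ≈ h → (f ⊗₁ id {D}) ∘ (g ⊗₁ id) ≈ h ⊗₁ id
  glue₁ p = glue p identityˡ

  glue₂ : ∀ {A B C D} {f : B ⇒ C} {g : A ⇒ B} {h : A ⇒ C} →
          f ∘ g ≈ h → (id {D} ⊗₁ f) ∘ (id ⊗₁ g) ≈ id ⊗₁ h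
  glue₂ p = glue identityˡ p

  merge₁ : ∀ {A B C D} {f : B ⇒ C} {g : A ⇒ B} → (f ⊗₁ id {D}) ∘ (g ⊗₁ id) ≈ (f ∘ g) ⊗₁ id
  merge₁ = glue₁ Eq.refl

  merge₂ : ∀ {A B C D} {f : B ⇒ C} {g : A ⇒ B} → (id {D} ⊗₁ f) ∘ (id ⊗₁ g) ≈ id ⊗₁ (f ∘ g)
  merge₂ = glue₂ Eq.refl

  square₁ : ∀ {A B C D E} {f : B ⇒ D} {g : A ⇒ B} {h : C ⇒ D} {k : A ⇒ C} →
            f ∘ g ≈ h ∘ k → (f ⊗₁ id {E}) ∘ (g ⊗₁ id) ≈ (h ⊗₁ id) ∘ (k ⊗₁ id)
  square₁ p = glue₁ p ○ ⟺ merge₁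

  square₂ : ∀ {A B C D E} {f : B ⇒ D} {g : A ⇒ B} {h : C ⇒ D} {k : A ⇒ C} →
            f ∘ g ≈ h ∘ k → (id {E} ⊗₁ f) ∘ (id ⊗₁ g) ≈ (id ⊗₁ h) ∘ (id ⊗₁ k)
  square₂ p = glue₂ p ○ ⟺ merge₂

  ⊗-iso₁ : ∀ {A B C} {f : B ⇒ A} {g : A ⇒ B} → f ∘ g ≈ id → (f ⊗₁ id {C}) ∘ (g ⊗₁ id) ≈ id
  ⊗-iso₁ p = glue₁ p ○ ⊗-identity

  ⊗-iso₂ : ∀ {A B C} {f : B ⇒ A} {g : A ⇒ B} → f ∘ g ≈ id → (id {C} ⊗₁ f) ∘ (id ⊗₁ g) ≈ id
  ⊗-iso₂ p = glue₂ p ○ ⊗-identity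

  serialize₁₂ : ∀ {A B C D} {f : A ⇒ B} {g : C ⇒ D} → f ⊗₁ g ≈ (f ⊗₁ id) ∘ (id ⊗₁ g)
  serialize₁₂ = ⟺ (glue identityʳ identityˡ)

  serialize₂₁ : ∀ {A B C D} {f : A ⇒ B} {g : C ⇒ D} → f ⊗₁ g ≈ (id ⊗₁ g) ∘ (f ⊗₁ id)
  serialize₂₁ = ⟺ (glue identityˡ identityʳ)

  slide : ∀ {A B C D} {f : A ⇒ B} {g : C ⇒ D} → (f ⊗₁ id) ∘ (id ⊗₁ g) ≈ (id ⊗₁ g) ∘ (f ⊗₁ id)
  slide = ⟺ serialize₁₂ ○ serialize₂₁

  α-natural₁ : ∀ {A B C D} {f : A ⇒ D} → α D B C ∘ (f ⊗₁ id) ≈ ((f ⊗₁ id) ⊗₁ id) ∘ α A B C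
  α-natural₁ = refl⟩∘⟨ Eq.refl ⟩⊗⟨ ⟺ ⊗-identity ○ α-natural

  α-natural₃ : ∀ {A B C D} {f : C ⇒ D} → α A B D ∘ (id ⊗₁ (id ⊗₁ f)) ≈ (id ⊗₁ f) ∘ α A B C
  α-natural₃ = α-natural ○ (⊗-identity ⟩⊗⟨ Eq.refl) ⟩∘⟨refl

  α⁻¹-natural : ∀ {A B C D E F} {f : A ⇒ D} {g : B ⇒ E} {h : C ⇒ F} →
                α⁻¹ D E F ∘ ((f ⊗₁ g) ⊗₁ h) ≈ (f ⊗₁ (g ⊗₁ h)) ∘ α⁻¹ A B C
  α⁻¹-natural = flip-square α-isoʳ α-isoˡ (⟺ α-natural)

  α⁻¹-natural₁ : ∀ {A B C D} {f : A ⇒ D} → α⁻¹ D B C ∘ ((f ⊗₁ id) ⊗₁ id) ≈ (f ⊗₁ id) ∘ α⁻¹ A B C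
  α⁻¹-natural₁ = flip-square α-isoʳ α-isoˡ (⟺ α-natural₁)

  α⁻¹-natural₃ : ∀ {A B C D} {f : C ⇒ D} → α⁻¹ A B D ∘ (id ⊗₁ f) ≈ (id ⊗₁ (id ⊗₁ f)) ∘ α⁻¹ A B C
  α⁻¹-natural₃ = flip-square α-isoʳ α-isoˡ (⟺ α-natural₃)

  ℓ⁻¹-natural : ∀ {A B} {f : A ⇒ B} → ℓ⁻¹ B ∘ f ≈ (id ⊗₁ f) ∘ ℓ⁻¹ A
  ℓ⁻¹-natural = flip-square ℓ-isoʳ ℓ-isoˡ (⟺ ℓ-natural)

  ρ⁻¹-natural : ∀ {A B} {f : A ⇒ B} → ρ⁻¹ B ∘ f ≈ (f ⊗₁ id) ∘ ρ⁻¹ A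
  ρ⁻¹-natural = flip-square ρ-isoʳ ρ-isoˡ (⟺ ρ-natural)

  -- `ℓ` is a natural isomorphism from `K ⊗₀ -` to the identity functor.
  K⊗-faithful : ∀ {A B} {f g : A ⇒ B} → id {K} ⊗₁ f ≈ id ⊗₁ g → f ≈ g
  K⊗-faithful p = cancel-epi (ℓ _) (ℓ⁻¹ _) ℓ-isoʳ (⟺ ℓ-natural ○ refl⟩∘⟨ p ○ ℓ-natural)

  ⊗K-faithful : ∀ {A B} {f g : A ⇒ B} → f ⊗₁ id {K} ≈ g ⊗₁ id → f ≈ g
  ⊗K-faithful p = cancel-epi (ρ _) (ρ⁻¹ _) ρ-isoʳ (⟺ ρ-natural ○ refl⟩∘⟨ p ○ ρ-natural)

  -- Kelly's argument: after applying the faithful `K ⊗₀ -` and composing with the invertible `α`,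
  -- the two sides are joined by the pentagon, the triangle and naturality of `α`.
  ℓ-⊗ : ∀ {A B} → (ℓ A ⊗₁ id) ∘ α K A B ≈ ℓ (A ⊗₀ B)
  ℓ-⊗ {A} {B} = K⊗-faithful (cancel-mono (α K A B) (α⁻¹ K A B) α-isoˡ (⟺
    ( refl⟩∘⟨ ⟺ triangle
    ○ extendʳ α-natural₁
    ○ refl⟩∘⟨ pentagon
    ○ pullˡ (glue₁ triangle)
    ○ extendʳ (⟺ α-natural)
    ○ refl⟩∘⟨ merge₂)))

  -- The mirror image of `ℓ-⊗`, with `- ⊗₀ K` as the faithful functor and two associators cancelled.
  ρ-⊗ : ∀ {A B} → ρ (A ⊗₀ B) ∘ α A B K ≈ id ⊗₁ ρ B
  ρ-⊗ {A} {B} = ⊗K-faithful (cancel-epi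
    (α A (B ⊗₀ K) K ∘ (id ⊗₁ α B K K)) ((id ⊗₁ α⁻¹ B K K) ∘ α⁻¹ A (B ⊗₀ K) K)
    (assoc ○ refl⟩∘⟨ cancelˡ (⊗-iso₂ α-isoʳ) ○ α-isoʳ)
    ( pushˡ (⟺ merge₁)
    ○ refl⟩∘⟨ ⟺ pentagon
    ○ pullˡ triangle
    ○ ⟺ α-natural₃
    ○ refl⟩∘⟨ ⟺ (glue₂ triangle)
    ○ extendʳ α-natural))

  -- Naturality of `ℓ` at the morphism `ℓ A` itself, with one `ℓ` cancelled.
  ℓ-K⊗ : ∀ {A} → ℓ (K ⊗₀ A) ≈ id ⊗₁ ℓ A
  ℓ-K⊗ = cancel-mono (ℓ _) (ℓ⁻¹ _) ℓ-isoˡ (⟺ ℓ-natural)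

  -- Tensored with `K` and composed with `α`, both sides become `id ⊗₁ ℓ K`: one by `ℓ-⊗` and
  -- `ℓ-K⊗`, the other by the triangle.
  ℓ-K≈ρ-K : ℓ K ≈ ρ K
  ℓ-K≈ρ-K = ⊗K-faithful (cancel-epi (α K K K) (α⁻¹ K K K) α-isoʳ
    (ℓ-⊗ ○ ℓ-K⊗ ○ ⟺ triangle))

  ℓ⁻¹-⊗ : ∀ {A B} → α K A B ∘ ℓ⁻¹ (A ⊗₀ B) ≈ ℓ⁻¹ A ⊗₁ id
  ℓ⁻¹-⊗ = cancel-mono (ℓ _ ⊗₁ id) (ℓ⁻¹ _ ⊗₁ id) (⊗-iso₁ ℓ-isoˡ)
    (pullˡ ℓ-⊗ ○ ℓ-isoʳ ○ ⟺ (⊗-iso₁ ℓ-isoʳ))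

  triangle⁻¹ : ∀ {A B} → α A K B ∘ (id ⊗₁ ℓ⁻¹ B) ≈ ρ⁻¹ A ⊗₁ id
  triangle⁻¹ = cancel-mono (ρ _ ⊗₁ id) (ρ⁻¹ _ ⊗₁ id) (⊗-iso₁ ρ-isoˡ)
    (pullˡ triangle ○ ⊗-iso₂ ℓ-isoʳ ○ ⟺ (⊗-iso₁ ρ-isoʳ))

  ρ⁻¹-⊗ : ∀ {A B} → α A B K ∘ (id ⊗₁ ρ⁻¹ B) ≈ ρ⁻¹ (A ⊗₀ B)
  ρ⁻¹-⊗ = cancel-mono (ρ _) (ρ⁻¹ _) ρ-isoˡ (pullˡ ρ-⊗ ○ ⊗-iso₂ ρ-isoʳ ○ ⟺ ρ-isoʳ)

  ℓ⁻¹-K≈ρ⁻¹-K : ℓ⁻¹ K ≈ ρ⁻¹ K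
  ℓ⁻¹-K≈ρ⁻¹-K = cancel-mono (ℓ K) (ℓ⁻¹ K) ℓ-isoˡ (ℓ-isoʳ ○ ⟺ ρ-isoʳ ○ ⟺ ℓ-K≈ρ-K ⟩∘⟨refl)

  -- Up to associators τ is γ on the last three factors, which reduces the coherence of τ to
  -- hexagons for γ.
  γ : ∀ B C D → B ⊗₀ (C ⊗₀ D) ⇒ C ⊗₀ (B ⊗₀ D)
  γ B C D = α⁻¹ C B D ∘ ((σ B C ⊗₁ id) ∘ α B C D)

  γ-natural : ∀ {A B C D E F} {f : A ⇒ D} {g : B ⇒ E} {h : C ⇒ F} →
              γ D E F ∘ (f ⊗₁ (g ⊗₁ h)) ≈ (g ⊗₁ (f ⊗₁ h)) ∘ γ A B C
  γ-natural = assoc ○ refl⟩∘⟨ (assoc ○ refl⟩∘⟨ α-natural ○ extendʳ (glue-squares σ-natural id-comm))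
    ○ extendʳ α⁻¹-natural

  γ-natural₃ : ∀ {A B C D} {f : C ⇒ D} → γ A B D ∘ (id ⊗₁ (id ⊗₁ f)) ≈ (id ⊗₁ (id ⊗₁ f)) ∘ γ A B C
  γ-natural₃ = γ-natural

  γ-natural₁ : ∀ {A B C D} {f : A ⇒ B} → γ B C D ∘ (f ⊗₁ id) ≈ (id ⊗₁ (f ⊗₁ id)) ∘ γ A C D
  γ-natural₁ = refl⟩∘⟨ Eq.refl ⟩⊗⟨ ⟺ ⊗-identity ○ γ-natural

  γ-involutive : ∀ {A B C} → γ B A C ∘ γ A B C ≈ id
  γ-involutive = assoc ○ refl⟩∘⟨ (assoc ○ refl⟩∘⟨ cancelˡ α-isoʳ ○ cancelˡ (⊗-iso₁ σ-involutive)) ○ α-isoˡ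

  pentagon₂ : ∀ {A B C D} → (α⁻¹ A B C ⊗₁ id) ∘ α (A ⊗₀ B) C D
              ≈ α A (B ⊗₀ C) D ∘ ((id ⊗₁ α B C D) ∘ α⁻¹ A B (C ⊗₀ D))
  pentagon₂ = flip-square α-isoʳ (⊗-iso₁ α-isoˡ) pentagon ○ assoc

  pentagon₃ : ∀ {A B C D} → α⁻¹ (A ⊗₀ B) C D ∘ ((α A B C ⊗₁ id) ∘ α A (B ⊗₀ C) D)
              ≈ α A B (C ⊗₀ D) ∘ (id ⊗₁ α⁻¹ B C D)
  pentagon₃ = flip-square (⊗-iso₂ α-isoʳ) α-isoˡ (assoc ○ ⟺ pentagon)

  -- Swapping the first two factors does not see how the rest is bracketed, so a further factor `Z`
  -- is carried along.
  γ-tail : ∀ {B C D Z} → (γ B C D ⊗₁ id) ∘ (α B (C ⊗₀ D) Z ∘ (id ⊗₁ α C D Z))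
           ≈ α C (B ⊗₀ D) Z ∘ ((id ⊗₁ α B D Z) ∘ γ B C (D ⊗₀ Z))
  γ-tail = pushˡ (⊗-resp-≈ Eq.refl (⟺ identityˡ) ○ ⊗-homomorphism)
    ○ refl⟩∘⟨ (pushˡ (⟺ merge₁) ○ refl⟩∘⟨ ⟺ pentagon ○ extendʳ (⟺ α-natural₁))
    ○ extendʳ pentagon₂ ○ refl⟩∘⟨ assoc

  -- The hexagon axiom solved for the braiding past a tensor product; the swap with the first factor
  -- becomes `γ`.
  σ-hexagon : ∀ {A B C} → σ A (B ⊗₀ C) ≈ α B C A ∘ ((id ⊗₁ σ A C) ∘ γ A B C)
  σ-hexagon = cancel-mono (α⁻¹ _ _ _) (α _ _ _) α-isoʳ (cancel-epi (α⁻¹ _ _ _) (α _ _ _) α-isoˡ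
    ( assoc ○ hexagon
    ○ ⟺ ( cancelˡ α-isoˡ ⟩∘⟨refl ○ assoc
        ○ refl⟩∘⟨ (assoc ○ refl⟩∘⟨ (assoc ○ elimʳ α-isoʳ)))))

  -- The inverse of `σ-hexagon`, since `σ` and `γ` are involutive.
  σ-hexagon′ : ∀ {A B C} → σ (A ⊗₀ B) C ∘ α A B C ≈ γ A C B ∘ (id ⊗₁ σ B C)
  σ-hexagon′ = cancel-mono (σ _ _) (σ _ _) σ-involutive
    ( cancelˡ σ-involutive
    ○ ⟺ ( pushˡ σ-hexagon ○ refl⟩∘⟨ (assoc ○ refl⟩∘⟨ cancelˡ γ-involutive ○ ⊗-iso₂ σ-involutive)
        ○ identityʳ))

  -- Passing `C ⊗₀ E` amounts to passing `C`, then `E`: `σ-hexagon` splits the swap and pentagons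
  -- move the brackets.
  γ-hexagon : ∀ {B C E X} → γ B (C ⊗₀ E) X ∘ (id ⊗₁ α C E X)
              ≈ α C E (B ⊗₀ X) ∘ ((id ⊗₁ γ B E X) ∘ γ B C (E ⊗₀ X))
  γ-hexagon =
      assoc ○ refl⟩∘⟨ assoc
    ○ refl⟩∘⟨ ( pushˡ (σ-hexagon ⟩⊗⟨ Eq.refl ○ ⟺ merge₁)
              ○ refl⟩∘⟨ ( pushˡ (⟺ merge₁) ○ refl⟩∘⟨ γ-tail ○ extendʳ (⟺ α-natural)))
    ○ refl⟩∘⟨ ⟺ assoc ○ pullˡ pentagon₃ ○ assoc
    ○ refl⟩∘⟨ (refl⟩∘⟨ pullˡ merge₂ ○ pullˡ merge₂)

  γ-hexagon′ : ∀ {B D E X} → γ (B ⊗₀ D) E X ∘ α B D (E ⊗₀ X)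
               ≈ (id ⊗₁ α B D X) ∘ (γ B E (D ⊗₀ X) ∘ (id ⊗₁ γ D E X))
  γ-hexagon′ = cancel-mono (γ _ _ _) (γ _ _ _) γ-involutive
    ( cancelˡ γ-involutive
    ○ ⟺ ( extendʳ γ-hexagon ○ refl⟩∘⟨ (assoc ○ refl⟩∘⟨ cancelˡ γ-involutive ○ ⊗-iso₂ γ-involutive) ○ identityʳ))

  ℓ-⊗⁻¹ : ∀ {A B} → ℓ (A ⊗₀ B) ∘ α⁻¹ K A B ≈ ℓ A ⊗₁ id
  ℓ-⊗⁻¹ = ⟺ ℓ-⊗ ⟩∘⟨refl ○ assoc ○ elimʳ α-isoʳ

  ℓ-γ : ∀ {A B} → ℓ (A ⊗₀ B) ∘ γ A K B ≈ id ⊗₁ ℓ B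
  ℓ-γ = ⟺ (cancel-mono (σ _ _) (σ _ _) σ-involutive
    (σ-natural ○ refl⟩∘⟨ σ-hexagon ○ pullˡ ℓ-⊗ ○ extendʳ ℓ-natural))

  -- This compatibility is not among the axioms; after tensoring with `K` it follows from the
  -- hexagon through `ℓ-γ`.
  ℓ-σ : ∀ {A} → ℓ A ∘ σ A K ≈ ρ A
  ℓ-σ {A} = ⊗K-faithful (cancel-epi (α A K K) (α⁻¹ A K K) α-isoʳ
    (pushˡ (⟺ merge₁) ○ ⟺ (pullˡ ℓ-⊗⁻¹) ○ ℓ-γ ○ ⟺ triangle))

  ⊗ℓ-γ : ∀ {A B} → (id ⊗₁ ℓ B) ∘ γ K A B ≈ ℓ (A ⊗₀ B)
  ⊗ℓ-γ = ⟺ ℓ-γ ⟩∘⟨refl ○ assoc ○ elimʳ γ-involutive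

  σ-KK : σ K K ≈ id
  σ-KK = cancel-mono (ℓ K) (ℓ⁻¹ K) ℓ-isoˡ (ℓ-σ ○ ⟺ ℓ-K≈ρ-K ○ ⟺ identityʳ)

  τ-γ : ∀ {A B C D} → τ A B C D ≈ α A C (B ⊗₀ D) ∘ ((id ⊗₁ γ B C D) ∘ α⁻¹ A B (C ⊗₀ D))
  τ-γ = refl⟩∘⟨ (refl⟩∘⟨ pullˡ merge₂ ○ pullˡ merge₂)

  -- Precomposing with `α` removes the inverse associator of `τ-γ`; in this form equations for `τ`
  -- turn into equations for `γ`.
  τ-α : ∀ {A B C D} → τ A B C D ∘ α A B (C ⊗₀ D) ≈ α A C (B ⊗₀ D) ∘ (id ⊗₁ γ B C D)
  τ-α = pushˡ τ-γ ○ refl⟩∘⟨ (assoc ○ elimʳ α-isoˡ)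

  τ-natural : ∀ {A B C D A′ B′ C′ D′} {f : A ⇒ A′} {g : B ⇒ B′} {h : C ⇒ C′} {k : D ⇒ D′} →
              τ A′ B′ C′ D′ ∘ ((f ⊗₁ g) ⊗₁ (h ⊗₁ k)) ≈ ((f ⊗₁ h) ⊗₁ (g ⊗₁ k)) ∘ τ A B C D
  τ-natural = pushˡ τ-γ
    ○ refl⟩∘⟨ (assoc ○ refl⟩∘⟨ α⁻¹-natural ○ extendʳ (glue-squares id-comm γ-natural))
    ○ extendʳ α-natural ○ refl⟩∘⟨ ⟺ τ-γ

  τ-involutive : ∀ {A B C D} → τ A C B D ∘ τ A B C D ≈ id
  τ-involutive = refl⟩∘⟨ τ-γ ○ extendʳ τ-α ○ refl⟩∘⟨ cancelˡ (⊗-iso₂ γ-involutive) ○ α-isoʳ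

  -- With all six factors bracketed to the right, each side becomes, up to associators, the same
  -- three moves: `D` past `E`, then `B` past `C`, then `B` past `E`.
  τ-assoc : ∀ {A B C D E F} →
    (α A C E ⊗₁ α B D F) ∘ (τ A B (C ⊗₀ E) (D ⊗₀ F) ∘ (id ⊗₁ τ C D E F))
    ≈ τ (A ⊗₀ C) (B ⊗₀ D) E F ∘ ((τ A B C D ⊗₁ id) ∘ α (A ⊗₀ B) (C ⊗₀ D) (E ⊗₀ F))
  τ-assoc {A} {B} {C} {D} {E} {F} = cancel-epi
    (α A B _ ∘ (id ⊗₁ (id ⊗₁ α C D _))) ((id ⊗₁ (id ⊗₁ α⁻¹ C D _)) ∘ α⁻¹ A B _)
    (assoc ○ refl⟩∘⟨ cancelˡ (⊗-iso₂ (⊗-iso₂ α-isoʳ)) ○ α-isoʳ)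
    (left ○ ⟺ right)
    where
    left : ((α A C E ⊗₁ α B D F) ∘ (τ A B (C ⊗₀ E) (D ⊗₀ F) ∘ (id ⊗₁ τ C D E F)))
             ∘ (α A B _ ∘ (id ⊗₁ (id ⊗₁ α C D _)))
           ≈ α (A ⊗₀ C) E ((B ⊗₀ D) ⊗₀ F) ∘ (α A C _ ∘ ((id ⊗₁ (id ⊗₁ (id ⊗₁ α B D F)))
             ∘ (id ⊗₁ ((id ⊗₁ γ B E (D ⊗₀ F)) ∘ (γ B C _ ∘ (id ⊗₁ (id ⊗₁ γ D E F)))))))
    left =
        assoc ○ refl⟩∘⟨ (assoc ○ refl⟩∘⟨ (extendʳ (⟺ α-natural₃) ○ refl⟩∘⟨ glue₂ (glue₂ τ-α))
          ○ extendʳ τ-α ○ refl⟩∘⟨ (merge₂ ○ Eq.refl ⟩⊗⟨ (refl⟩∘⟨ ⟺ merge₂ ○ extendʳ γ-hexagon ○ refl⟩∘⟨ assoc) ○ ⟺ merge₂))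
      ○ serialize₂₁ ⟩∘⟨refl ○ assoc
      ○ refl⟩∘⟨ (refl⟩∘⟨ ⟺ assoc ○ ⟺ assoc ○ ⟺ pentagon ⟩∘⟨refl ○ assoc)
      ○ extendʳ (⟺ α-natural₃)
      ○ refl⟩∘⟨ extendʳ (⟺ α-natural₃)

    right : (τ (A ⊗₀ C) (B ⊗₀ D) E F ∘ ((τ A B C D ⊗₁ id) ∘ α (A ⊗₀ B) (C ⊗₀ D) (E ⊗₀ F)))
             ∘ (α A B _ ∘ (id ⊗₁ (id ⊗₁ α C D _)))
           ≈ α (A ⊗₀ C) E ((B ⊗₀ D) ⊗₀ F) ∘ (α A C _ ∘ ((id ⊗₁ (id ⊗₁ (id ⊗₁ α B D F)))
             ∘ (id ⊗₁ ((id ⊗₁ γ B E (D ⊗₀ F)) ∘ (γ B C _ ∘ (id ⊗₁ (id ⊗₁ γ D E F)))))))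
    right =
        assoc ○ refl⟩∘⟨ (assoc ○ refl⟩∘⟨ (pullˡ pentagon ○ assoc ○ refl⟩∘⟨ (assoc ○ refl⟩∘⟨ merge₂))
          ○ pullˡ (glue₁ τ-α ○ ⟺ merge₁) ○ assoc
          ○ refl⟩∘⟨ (extendʳ (⟺ α-natural) ○ refl⟩∘⟨ (glue₂ γ-tail ○ ⟺ merge₂))
          ○ refl⟩∘⟨ ⟺ assoc ○ ⟺ assoc ○ ⟺ pentagon ⟩∘⟨refl ○ assoc)
      ○ extendʳ τ-α
      ○ refl⟩∘⟨ (extendʳ (⟺ α-natural₃) ○ refl⟩∘⟨ (merge₂ ○ Eq.refl ⟩⊗⟨
          ( pullˡ (glue₂ γ-hexagon′ ○ ⟺ merge₂) ○ assoc
          ○ refl⟩∘⟨ (pushˡ (⟺ merge₂) ○ refl⟩∘⟨ ⟺ γ-natural₃)) ○ ⟺ merge₂))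

  -- This is `τ-assoc` with its four interchanges moved to the opposite sides, each being inverted
  -- by another `τ`.
  τ-coassoc : ∀ {P Q R A B C} →
    α (P ⊗₀ A) (Q ⊗₀ B) (R ⊗₀ C) ∘ ((id ⊗₁ τ Q R B C) ∘ τ P (Q ⊗₀ R) A (B ⊗₀ C))
    ≈ (τ P Q A B ⊗₁ id) ∘ (τ (P ⊗₀ Q) R (A ⊗₀ B) C ∘ (α P Q R ⊗₁ α A B C))
  τ-coassoc {P} {Q} {R} {A} {B} {C} =
    cancel-mono (τ P A Q B ⊗₁ id) (τ P Q A B ⊗₁ id) (⊗-iso₁ τ-involutive)
    (cancel-mono (τ (P ⊗₀ Q) (A ⊗₀ B) R C) (τ (P ⊗₀ Q) R (A ⊗₀ B) C) τ-involutive
      ( refl⟩∘⟨ ⟺ assoc ○ ⟺ assoc ○ ⟺ τ-assoc ⟩∘⟨refl ○ assoc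
      ○ refl⟩∘⟨ (assoc ○ refl⟩∘⟨ cancelˡ (⊗-iso₂ τ-involutive) ○ τ-involutive) ○ identityʳ
      ○ ⟺ (refl⟩∘⟨ cancelˡ (⊗-iso₁ τ-involutive) ○ cancelˡ τ-involutive)))

  σ-τ : ∀ {A B C D} → σ (A ⊗₀ C) (B ⊗₀ D) ∘ τ A B C D ≈ τ B A D C ∘ (σ A B ⊗₁ σ C D)
  σ-τ =
      refl⟩∘⟨ τ-γ
    ○ extendʳ σ-hexagon′
    ○ refl⟩∘⟨ pullˡ (glue₂ (pushˡ σ-hexagon ○ refl⟩∘⟨ (assoc ○ elimʳ γ-involutive)) ○ ⟺ merge₂)
    ○ refl⟩∘⟨ assoc ○ extendʳ γ-hexagon
    ○ refl⟩∘⟨ (assoc ○ refl⟩∘⟨ (assoc ○ refl⟩∘⟨ (assoc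
        ○ refl⟩∘⟨ (extendʳ α-natural₃ ○ elimʳ α-isoʳ) ○ ⟺ serialize₁₂)))
    ○ ⟺ (pushˡ τ-γ ○ refl⟩∘⟨ assoc)

  τ-σ : ∀ {A B C D} → (σ A B ⊗₁ σ C D) ∘ τ A C B D ≈ τ B D A C ∘ σ (A ⊗₀ C) (B ⊗₀ D)
  τ-σ = ⟺ (flip-square τ-involutive τ-involutive σ-τ)

  τ-unitˡ : ∀ {A B} → (ℓ A ⊗₁ ℓ B) ∘ τ K K A B ≈ ℓ (A ⊗₀ B) ∘ (ℓ K ⊗₁ id)
  τ-unitˡ = refl⟩∘⟨ τ-γ ○ pushˡ serialize₂₁ ○ refl⟩∘⟨ (pullˡ ℓ-⊗ ○ extendʳ ℓ-natural)
    ○ pullˡ ⊗ℓ-γ ○ refl⟩∘⟨ ℓ-⊗⁻¹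

  τ-unitʳ : ∀ {A B} → (ρ A ⊗₁ ρ B) ∘ τ A B K K ≈ ρ (A ⊗₀ B) ∘ (id ⊗₁ ℓ K)
  τ-unitʳ = ⟺ (glue ℓ-σ ℓ-σ) ⟩∘⟨refl ○ assoc ○ refl⟩∘⟨ τ-σ ○ extendʳ τ-unitˡ
    ○ refl⟩∘⟨ ⟺ σ-natural ○ pullˡ ℓ-σ

  -- Swapping two copies of `K` is trivial by `σ-KK`, so the associators left in `τ` cancel.
  τ-K-K : ∀ {A B} → τ A K K B ≈ id
  τ-K-K = τ-γ ○ refl⟩∘⟨ elimˡ (Eq.refl ⟩⊗⟨ (refl⟩∘⟨ elimˡ (σ-KK ⟩⊗⟨ Eq.refl ○ ⊗-identity) ○ α-isoˡ) ○ ⊗-identity)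
    ○ α-isoʳ

  τ-natural₁ : ∀ {A B C D A′ B′} {f : A ⇒ A′} {g : B ⇒ B′} →
               τ A′ B′ C D ∘ ((f ⊗₁ g) ⊗₁ id) ≈ ((f ⊗₁ id) ⊗₁ (g ⊗₁ id)) ∘ τ A B C D
  τ-natural₁ = refl⟩∘⟨ Eq.refl ⟩⊗⟨ ⟺ ⊗-identity ○ τ-natural

  τ-natural₁ˡ : ∀ {A B C D A′} {f : A ⇒ A′} →
                τ A′ B C D ∘ ((f ⊗₁ id) ⊗₁ id) ≈ ((f ⊗₁ id) ⊗₁ id) ∘ τ A B C D
  τ-natural₁ˡ = τ-natural₁ ○ (Eq.refl ⟩⊗⟨ ⊗-identity) ⟩∘⟨refl

  τ-natural₁ʳ : ∀ {A B C D B′} {g : B ⇒ B′} →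
                τ A B′ C D ∘ ((id ⊗₁ g) ⊗₁ id) ≈ (id ⊗₁ (g ⊗₁ id)) ∘ τ A B C D
  τ-natural₁ʳ = τ-natural₁ ○ (⊗-identity ⟩⊗⟨ Eq.refl) ⟩∘⟨refl

  τ-natural₂ : ∀ {A B C D C′ D′} {f : C ⇒ C′} {g : D ⇒ D′} →
               τ A B C′ D′ ∘ (id ⊗₁ (f ⊗₁ g)) ≈ ((id ⊗₁ f) ⊗₁ (id ⊗₁ g)) ∘ τ A B C D
  τ-natural₂ = refl⟩∘⟨ ⟺ ⊗-identity ⟩⊗⟨ Eq.refl ○ τ-natural

  τ-unitˡ′ : ∀ {A B} → ℓ (A ⊗₀ B) ∘ ((ℓ K ⊗₁ id) ∘ τ K A K B) ≈ ℓ A ⊗₁ ℓ B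
  τ-unitˡ′ = pullˡ (⟺ τ-unitˡ) ○ assoc ○ elimʳ τ-involutive

  τ-unitˡ⁻¹ : ∀ {A B} → τ K K A B ∘ ((ℓ⁻¹ K ⊗₁ id) ∘ ℓ⁻¹ (A ⊗₀ B)) ≈ ℓ⁻¹ A ⊗₁ ℓ⁻¹ B
  τ-unitˡ⁻¹ = cancel-mono (ℓ _ ⊗₁ ℓ _) (ℓ⁻¹ _ ⊗₁ ℓ⁻¹ _) (glue ℓ-isoˡ ℓ-isoˡ ○ ⊗-identity)
    ( extendʳ τ-unitˡ ○ refl⟩∘⟨ cancelˡ (⊗-iso₁ ℓ-isoʳ) ○ ℓ-isoʳ
    ○ ⟺ (glue ℓ-isoʳ ℓ-isoʳ ○ ⊗-identity))

  triangle′ : ∀ {A B} → (id ⊗₁ ℓ B) ∘ α⁻¹ A K B ≈ ρ A ⊗₁ id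
  triangle′ = ⟺ triangle ⟩∘⟨refl ○ assoc ○ elimʳ α-isoʳ

  pentagon⁻¹ : ∀ {A B C D} → α⁻¹ A B (C ⊗₀ D) ∘ (α⁻¹ (A ⊗₀ B) C D ∘ (α A B C ⊗₁ id))
               ≈ (id ⊗₁ α⁻¹ B C D) ∘ α⁻¹ A (B ⊗₀ C) D
  pentagon⁻¹ = cancel-epi (α _ _ _) (α⁻¹ _ _ _) α-isoʳ
    ( assoc ○ refl⟩∘⟨ (assoc ○ pentagon₃) ○ cancelˡ α-isoˡ ○ ⟺ (assoc ○ elimʳ α-isoˡ))

-- The Hopf monad of a cocommutative Hopf monoid.

module TensorMonad {o c r} {𝕏 : Category o c r} {M : SymmetricMonoidal 𝕏} (L : MonoidalCoalgebraModality M) where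
  open Category 𝕏
  open SymmetricMonoidal M
  open Chasing 𝕏
  open Coherence M
  open MonoidalNotions M
  open OverModality L

  module _ {H : Obj} {∇ : H ⊗₀ H ⇒ H} {u : K ⇒ H} {Δ : H ⇒ H ⊗₀ H} {ϵ : H ⇒ K} {S : H ⇒ H}
           (isCocommHopf : IsCocommutativeHopfMonoid H ∇ u Δ ϵ S) where
    open IsCocommutativeHopfMonoid isCocommHopf
    open IsHopfMonoid isHopfMonoid
    open IsBimonoid isBimonoid
    open IsMonoidObj isMonoid
    open IsComonoidObj isComonoid

    private
      T = tensorMonad H ∇ u Δ ϵ
      open module T = MonadData T

    tensor-isMonad : IsMonad T
    tensor-isMonad = record
      { T-identity = ⊗-identity
      ; T-homomorphism = ⟺ merge₂
      ; T-resp-≈ = Eq.refl ⟩⊗⟨_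
      ; μ-natural = assoc ○ refl⟩∘⟨ α-natural₃ ○ extendʳ slide
      ; η-natural = assoc ○ refl⟩∘⟨ ℓ⁻¹-natural ○ extendʳ slide
      ; monad-assoc = assoc ○ refl⟩∘⟨ (refl⟩∘⟨ ⟺ merge₂ ○ extendʳ α-natural)
          ○ extendʳ (square₁ ∇-assoc) ○ refl⟩∘⟨ (pushˡ (⟺ merge₁) ○ refl⟩∘⟨ ⟺ pentagon)
          ○ ⟺ (assoc ○ refl⟩∘⟨ extendʳ α-natural₁)
      ; monad-idˡ = assoc ○ refl⟩∘⟨ (extendʳ α-natural₁ ○ refl⟩∘⟨ ℓ⁻¹-⊗ ○ merge₁)
          ○ glue₁ ∇-unitˡ ○ ⊗-identity
      ; monad-idʳ = assoc ○ refl⟩∘⟨ (refl⟩∘⟨ ⟺ merge₂ ○ extendʳ α-natural ○ refl⟩∘⟨ triangle⁻¹ ○ merge₁)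
          ○ glue₁ ∇-unitʳ ○ ⊗-identity
      }

    open IsMonad tensor-isMonad

    private
      -- Once `σ` has passed through `τ` it swaps the two copies of `H`, which cocommutativity
      -- absorbs.
      n-symm : ∀ {A B} → σ (T₀ A) (T₀ B) ∘ n A B ≈ n B A ∘ T₁ (σ A B)
      n-symm = pullˡ σ-τ ○ assoc ○ refl⟩∘⟨ glue-squares (cocommutative ○ ⟺ identityʳ) (⟺ id-comm) ○ ⟺ assoc

      n-unit : ∀ {A} → ℓ (T₀ A) ∘ ((nK ⊗₁ id) ∘ n K A) ≈ T₁ (ℓ A)
      n-unit =
          refl⟩∘⟨ pushˡ (⟺ (ρ-natural ⟩⊗⟨ Eq.refl) ○ ⟺ merge₁)
        ○ refl⟩∘⟨ (⟺ ℓ-K≈ρ-K ⟩⊗⟨ Eq.refl ⟩∘⟨ (extendʳ (⟺ τ-natural₁ˡ) ○ refl⟩∘⟨ merge₁))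
        ○ refl⟩∘⟨ ⟺ assoc ○ ⟺ assoc ○ τ-unitˡ′ ⟩∘⟨refl
        ○ glue Δ-counitˡ identityʳ

    tensor-isSymmetricComonoidalMonad : IsSymmetricComonoidalMonad T
    tensor-isSymmetricComonoidalMonad = record
      { isMonad = tensor-isMonad
      ; n-natural = assoc ○ refl⟩∘⟨ slide ○ extendʳ τ-natural₂
      ; n-assoc =
            refl⟩∘⟨ (pushˡ (⟺ merge₂) ○ refl⟩∘⟨ (extendʳ (⟺ τ-natural₁ʳ) ○ refl⟩∘⟨ merge₁))
          ○ refl⟩∘⟨ ⟺ assoc ○ ⟺ assoc ○ τ-coassoc ⟩∘⟨refl ○ assoc
          ○ refl⟩∘⟨ (assoc ○ refl⟩∘⟨ glue Δ-coassoc identityʳ)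
          ○ ⟺ ( pushˡ (⟺ merge₁)
              ○ refl⟩∘⟨ ( refl⟩∘⟨ (assoc ○ refl⟩∘⟨ ⟺ serialize₁₂)
                        ○ extendʳ (⟺ τ-natural₁ˡ) ○ refl⟩∘⟨ glue Eq.refl identityˡ))
      ; n-unitˡ = n-unit
      -- The right unit law is the left one conjugated by the symmetry.
      ; n-unitʳ = ⟺ ℓ-σ ⟩∘⟨refl ○ assoc ○ refl⟩∘⟨ (extendʳ σ-natural ○ refl⟩∘⟨ n-symm)
          ○ refl⟩∘⟨ ⟺ assoc ○ pullˡ n-unit ○ glue₂ ℓ-σ
      ; n-symmetric = n-symm
      -- `Δ-∇` splits the product; `τ-assoc` then rearranges the two nested interchanges to match
      -- those of `n` applied twice.
      ; μ-comonoidal =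
            assoc ○ refl⟩∘⟨ (pullˡ (glue₁ Δ-∇) ○ pushˡ (⟺ merge₁))
          ○ extendʳ τ-natural₁
          ○ refl⟩∘⟨ ( refl⟩∘⟨ (pushˡ (⟺ merge₁) ○ refl⟩∘⟨ ⟺ α-natural)
                    ○ refl⟩∘⟨ ⟺ assoc ○ ⟺ assoc ○ ⟺ τ-assoc ⟩∘⟨refl ○ assoc
                    ○ refl⟩∘⟨ (assoc ○ refl⟩∘⟨ glue identityˡ Eq.refl))
          ○ pullˡ (⟺ ⊗-homomorphism)
          ○ refl⟩∘⟨ ⟺ (assoc ○ refl⟩∘⟨ ⟺ serialize₁₂)
      ; μ-comonoidalK =
            assoc ○ refl⟩∘⟨ (extendʳ ρ-natural ○ refl⟩∘⟨ ρ-⊗)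
          ○ pullˡ ϵ-∇ ○ assoc ○ ℓ-K≈ρ-K ⟩∘⟨ glue identityʳ Eq.refl
          ○ ⟺ (⟺ ρ-natural ⟩∘⟨refl ○ assoc ○ refl⟩∘⟨ ⟺ serialize₁₂)
      ; η-comonoidal =
            assoc ○ refl⟩∘⟨ (pullˡ (glue₁ Δ-u ○ ⟺ merge₁) ○ assoc)
          ○ extendʳ τ-natural₁ ○ refl⟩∘⟨ τ-unitˡ⁻¹ ○ ⟺ ⊗-homomorphism
      ; η-comonoidalK =
            assoc ○ refl⟩∘⟨ extendʳ ρ-natural ○ cancelˡ ϵ-u ○ ⟺ ℓ-K≈ρ-K ⟩∘⟨refl ○ ℓ-isoʳ
      }

    private
      -- The comultiplication of the comonad that the comonoid `H` induces on `H ⊗₀ -`.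
      dup : ∀ X → H ⊗₀ X ⇒ H ⊗₀ (H ⊗₀ X)
      dup X = α⁻¹ H H X ∘ (Δ ⊗₁ id)

      dup-natural : ∀ {X Y} {f : X ⇒ Y} → dup Y ∘ (id ⊗₁ f) ≈ (id ⊗₁ (id ⊗₁ f)) ∘ dup X
      dup-natural = assoc ○ refl⟩∘⟨ slide ○ extendʳ α⁻¹-natural₃

      dup-coassoc : ∀ {X} → dup (H ⊗₀ X) ∘ dup X ≈ (id ⊗₁ dup X) ∘ dup X
      dup-coassoc =
          assoc ○ refl⟩∘⟨ extendʳ (⟺ α⁻¹-natural₁)
        ○ refl⟩∘⟨ refl⟩∘⟨ (glue₁ (⟺ Δ-coassoc) ○ ⟺ merge₁)
        ○ refl⟩∘⟨ ⟺ assoc ○ ⟺ assoc ○ pentagon⁻¹ ⟩∘⟨refl ○ assoc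
        ○ refl⟩∘⟨ (refl⟩∘⟨ ⟺ merge₁ ○ extendʳ α⁻¹-natural) ○ pullˡ merge₂

      -- In Sweedler notation W f is h ⊗ g ⊗ x ↦ h₁ ⊗ f(h₂)g ⊗ x.  It turns convolution into
      -- composition, so that W S inverts W id.
      W : H ⇒ H → ∀ X → H ⊗₀ (H ⊗₀ X) ⇒ H ⊗₀ (H ⊗₀ X)
      W f X = (id ⊗₁ (μ X ∘ (f ⊗₁ id))) ∘ dup (H ⊗₀ X)

      W-resp-≈ : ∀ {f g X} → f ≈ g → W f X ≈ W g X
      W-resp-≈ p = (Eq.refl ⟩⊗⟨ (refl⟩∘⟨ p ⟩⊗⟨ Eq.refl)) ⟩∘⟨refl

      -- Both sides send h ⊗ k ⊗ x to h₁ ⊗ f(h₂)g(h₃)k ⊗ x, by coassociativity of `dup` and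
      -- associativity of `μ`.
      W-∘ : ∀ {f g X} → W f X ∘ W g X ≈ W (∇ ∘ ((f ⊗₁ g) ∘ Δ)) X
      W-∘ =
          assoc ○ refl⟩∘⟨ (extendʳ dup-natural ○ refl⟩∘⟨ dup-coassoc ○ pullˡ merge₂) ○ pullˡ merge₂
        ○ (Eq.refl ⟩⊗⟨
            ( assoc
            ○ refl⟩∘⟨ (pullˡ (⟺ serialize₁₂ ○ ⟺ (glue identityˡ Eq.refl)) ○ assoc)
            ○ extendʳ monad-assoc
            ○ refl⟩∘⟨ (assoc ○ refl⟩∘⟨ (extendʳ α-natural ○ refl⟩∘⟨ cancelˡ α-isoʳ ○ merge₁) ○ merge₁)))
          ⟩∘⟨refl

      W-id : ∀ {X} → W (u ∘ ϵ) X ≈ id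
      W-id =
          -- The cancelled equation is the left unit law of the monad freed of its `ℓ⁻¹`:
          -- multiplying by `u` is `ℓ`.
          (Eq.refl ⟩⊗⟨ (refl⟩∘⟨ ⟺ merge₁ ○ pullˡ (cancel-epi (ℓ⁻¹ _) (ℓ _) ℓ-isoˡ (assoc ○ monad-idˡ ○ ⟺ ℓ-isoʳ)))
            ○ ⟺ merge₂) ⟩∘⟨refl
        ○ assoc ○ refl⟩∘⟨ extendʳ (⟺ α⁻¹-natural) ○ pullˡ triangle′
        ○ refl⟩∘⟨ merge₁ ○ glue₁ Δ-counitʳ ○ ⊗-identity

      W-iso : ∀ {X} → IsIso (W id X)
      W-iso = W S _ , W-∘ ○ W-resp-≈ antipodeˡ ○ W-id , W-∘ ○ W-resp-≈ antipodeʳ ○ W-id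

      -- By `γ-hexagon′`, the two copies of `H` can be multiplied before or after they are moved
      -- past `A`.
      γ-μ : ∀ {A B} → γ H A B ∘ (μ (A ⊗₀ B) ∘ (id ⊗₁ γ A H B)) ≈ (id ⊗₁ μ B) ∘ γ H A (H ⊗₀ B)
      γ-μ = refl⟩∘⟨ assoc ○ extendʳ γ-natural₁
        ○ refl⟩∘⟨ (pullˡ γ-hexagon′ ○ assoc ○ refl⟩∘⟨ (assoc ○ elimʳ (⊗-iso₂ γ-involutive)))
        ○ pullˡ merge₂

      -- `A` is moved past the second `H`, `W id` acts, and `A` is moved back. The result is the
      -- left fusion operator h ⊗ a ⊗ k ⊗ b ↦ h₁ ⊗ a ⊗ h₂k ⊗ b, which therefore inherits
      -- invertibility from `W id`.
      fusion-W : ∀ {A B} → α H A (H ⊗₀ B) ∘ ((id ⊗₁ γ H A B) ∘ (W id (A ⊗₀ B) ∘ (id ⊗₁ γ A H B)))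
                 ≈ (id ⊗₁ μ B) ∘ n A (H ⊗₀ B)
      fusion-W =
          refl⟩∘⟨ ( refl⟩∘⟨ ((Eq.refl ⟩⊗⟨ elimʳ ⊗-identity) ⟩∘⟨refl ⟩∘⟨refl ○ assoc ○ refl⟩∘⟨ dup-natural ○ pullˡ merge₂)
                  ○ pullˡ (glue₂ γ-μ ○ ⟺ merge₂) ○ assoc)
        ○ extendʳ α-natural₃
        ○ refl⟩∘⟨ ⟺ (pushˡ τ-γ ○ refl⟩∘⟨ assoc)

      fusionˡ : ∀ {A B} → IsIso ((id ⊗₁ μ B) ∘ n A (T₀ B))
      fusionˡ = iso-resp-≈ fusion-W
        (iso-∘ (α⁻¹ _ _ _ , α-isoˡ , α-isoʳ) (iso-∘ ⊗γ-iso (iso-∘ W-iso ⊗γ-iso)))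
        where
        ⊗γ-iso : ∀ {A B C D} → IsIso (id {A} ⊗₁ γ B C D)
        ⊗γ-iso = id ⊗₁ γ _ _ _ , ⊗-iso₂ γ-involutive , ⊗-iso₂ γ-involutive

    tensor-isSymmetricHopfMonad : IsSymmetricHopfMonad T
    tensor-isSymmetricHopfMonad = record
      { isSymComonoidalMonad = tensor-isSymmetricComonoidalMonad
      ; fusionˡ-iso = fusionˡ
      -- The right fusion operator is the left one conjugated by symmetries.
      ; fusionʳ-iso = iso-resp-≈
          (refl⟩∘⟨ (assoc ○ refl⟩∘⟨ ⟺ n-symm) ○ extendʳ σ-natural ○ refl⟩∘⟨ cancelˡ σ-involutive)
          (iso-∘ (σ _ _ , σ-involutive , σ-involutive)
            (iso-∘ fusionˡ (id ⊗₁ σ _ _ , ⊗-iso₂ σ-involutive , ⊗-iso₂ σ-involutive)))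
      }

-- Coherence of the modality, and the comonoid structure of a coalgebra.

module Modality {o c r} {𝕏 : Category o c r} {M : SymmetricMonoidal 𝕏} (L : MonoidalCoalgebraModality M) where
  open Category 𝕏
  open SymmetricMonoidal M
  open MonoidalCoalgebraModality L
  open OverModality L using (Δ^; e^; IsCoalgebra)
  open Chasing 𝕏
  open Coherence M

  !-∘ : ∀ {A B C} {f : B ⇒ C} {g : A ⇒ B} {h : A ⇒ C} → f ∘ g ≈ h → !₁ f ∘ !₁ g ≈ !₁ h
  !-∘ p = ⟺ !-homomorphism ○ !-resp-≈ p

  !-square : ∀ {A B C D} {f : B ⇒ D} {g : A ⇒ B} {h : C ⇒ D} {k : A ⇒ C} →
             f ∘ g ≈ h ∘ k → !₁ f ∘ !₁ g ≈ !₁ h ∘ !₁ k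
  !-square p = !-∘ p ○ !-homomorphism

  !-iso : ∀ {A B} {f : A ⇒ B} {g : B ⇒ A} → f ∘ g ≈ id → !₁ f ∘ !₁ g ≈ id
  !-iso p = !-∘ p ○ !-identity

  m-natural₁ : ∀ {A B C} {f : A ⇒ B} → m B C ∘ (!₁ f ⊗₁ id) ≈ !₁ (f ⊗₁ id) ∘ m A C
  m-natural₁ = refl⟩∘⟨ Eq.refl ⟩⊗⟨ ⟺ !-identity ○ m-natural

  m-natural₂ : ∀ {A B C} {f : A ⇒ B} → m C B ∘ (id ⊗₁ !₁ f) ≈ !₁ (id ⊗₁ f) ∘ m C A
  m-natural₂ = refl⟩∘⟨ ⟺ !-identity ⟩⊗⟨ Eq.refl ○ m-natural

  m-unitˡ⁻¹ : ∀ {A} → m K A ∘ ((mK ⊗₁ id) ∘ ℓ⁻¹ (!₀ A)) ≈ !₁ (ℓ⁻¹ A)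
  m-unitˡ⁻¹ = cancel-mono (!₁ (ℓ _)) (!₁ (ℓ⁻¹ _)) (!-iso ℓ-isoˡ)
    (refl⟩∘⟨ ⟺ assoc ○ pullˡ m-unitˡ ○ ℓ-isoʳ ○ ⟺ (!-iso ℓ-isoʳ))

  m-assoc⁻¹ : ∀ {A B C} → !₁ (α⁻¹ A B C) ∘ (m (A ⊗₀ B) C ∘ (m A B ⊗₁ id))
              ≈ m A (B ⊗₀ C) ∘ ((id ⊗₁ m B C) ∘ α⁻¹ (!₀ A) (!₀ B) (!₀ C))
  m-assoc⁻¹ = flip-square α-isoʳ (!-iso α-isoˡ) (assoc ○ m-assoc) ○ assoc

  -- `γ` is built from associators and one symmetry, and `m` is compatible with each of these.
  m-γ : ∀ {A B C} → !₁ (γ A B C) ∘ (m A (B ⊗₀ C) ∘ (id ⊗₁ m B C))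
        ≈ (m B (A ⊗₀ C) ∘ (id ⊗₁ m A C)) ∘ γ (!₀ A) (!₀ B) (!₀ C)
  m-γ = pushˡ !-homomorphism
    ○ refl⟩∘⟨ ( pushˡ !-homomorphism
              ○ refl⟩∘⟨ ⟺ m-assoc ○ extendʳ (⟺ m-natural₁) ○ refl⟩∘⟨ extendʳ (square₁ (⟺ m-symmetric)))
    ○ refl⟩∘⟨ ⟺ assoc ○ pullˡ m-assoc⁻¹ ○ assoc ○ refl⟩∘⟨ assoc ○ ⟺ assoc

  m-α : ∀ {A B C D} → (m (A ⊗₀ B) (C ⊗₀ D) ∘ (m A B ⊗₁ m C D)) ∘ α (!₀ A) (!₀ B) (!₀ C ⊗₀ !₀ D)
        ≈ !₁ (α A B (C ⊗₀ D)) ∘ (m A _ ∘ (id ⊗₁ (m B (C ⊗₀ D) ∘ (id ⊗₁ m C D))))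
  m-α = assoc ○ refl⟩∘⟨ (pushˡ serialize₁₂ ○ refl⟩∘⟨ ⟺ α-natural₃ ○ ⟺ assoc) ○ pullˡ m-assoc
    ○ assoc ○ refl⟩∘⟨ (assoc ○ refl⟩∘⟨ merge₂)

  -- Checked after precomposing with `α`, where `τ` reduces to `γ` and `m-γ` applies.
  m-τ : ∀ {A B C D} → !₁ (τ A B C D) ∘ (m (A ⊗₀ B) (C ⊗₀ D) ∘ (m A B ⊗₁ m C D))
        ≈ (m (A ⊗₀ C) (B ⊗₀ D) ∘ (m A C ⊗₁ m B D)) ∘ τ (!₀ A) (!₀ B) (!₀ C) (!₀ D)
  m-τ = cancel-epi (α _ _ _) (α⁻¹ _ _ _) α-isoʳ
    ( assoc ○ refl⟩∘⟨ m-α ○ extendʳ (!-square τ-α)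
    ○ refl⟩∘⟨ (extendʳ (⟺ m-natural₂) ○ refl⟩∘⟨ square₂ m-γ ○ ⟺ assoc)
    ○ ⟺ (assoc ○ refl⟩∘⟨ τ-α ○ pullˡ m-α ○ assoc))

  module Coalgebra {A : Obj} {ω : A ⇒ !₀ A} (isCoalgebra : IsCoalgebra A ω) where
    open IsCoalgebra isCoalgebra

    -- `ω` respects comultiplication: naturality moves `ω` past `ε` as `!₁ ω`, the coalgebra law
    -- turns `!₁ ω ∘ ω` into `δ A ∘ ω`, and `δ` is a comonoid morphism.
    Δ-ω : Δ A ∘ ω ≈ (ω ⊗₁ ω) ∘ Δ^ ω
    Δ-ω = ⟺ ( extendʳ (glue-squares (⟺ ε-natural) (⟺ ε-natural))
            ○ refl⟩∘⟨ (extendʳ (⟺ Δ-natural) ○ refl⟩∘⟨ ⟺ coalg-δ ○ extendʳ δ-comonoid-Δ)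
            ○ cancelˡ (glue comonad-idˡ comonad-idˡ ○ ⊗-identity))

    -- The coalgebra law exposes a `δ A`, to which `!Δ-δ` applies; the `ε` inside `Δ^ ω` then
    -- cancels against `δ`.
    Δ^-coalgebra-map : !₁ (Δ^ ω) ∘ ω ≈ m A A ∘ ((ω ⊗₁ ω) ∘ Δ^ ω)
    Δ^-coalgebra-map =
        pushˡ !-homomorphism
      ○ refl⟩∘⟨ (pushˡ !-homomorphism ○ refl⟩∘⟨ ⟺ coalg-δ ○ extendʳ !Δ-δ ○ refl⟩∘⟨ assoc)
      ○ extendʳ (⟺ m-natural)
      ○ refl⟩∘⟨ (cancelˡ (glue comonad-idʳ comonad-idʳ ○ ⊗-identity) ○ Δ-ω)

    e^-coalgebra-map : !₁ (e^ ω) ∘ ω ≈ mK ∘ e^ ω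
    e^-coalgebra-map = pushˡ !-homomorphism ○ refl⟩∘⟨ ⟺ coalg-δ ○ extendʳ !e-δ

    Δ^-cocommutative : σ A A ∘ Δ^ ω ≈ Δ^ ω
    Δ^-cocommutative = extendʳ σ-natural ○ refl⟩∘⟨ pullˡ Δ-cocomm

    Δ^-counitʳ : ρ A ∘ ((id ⊗₁ e^ ω) ∘ Δ^ ω) ≈ id
    Δ^-counitʳ =
        -- The identity is written as `ε A ∘ ω`, so that `Δ-ω` makes the counit law of `!₀ A`
        -- available.
        refl⟩∘⟨ ( (⟺ (glue coalg-ε Eq.refl)) ⟩∘⟨refl ○ assoc ○ refl⟩∘⟨ ⟺ Δ-ω ○ pushˡ serialize₁₂)
      ○ extendʳ ρ-natural ○ refl⟩∘⟨ (refl⟩∘⟨ ⟺ assoc ○ cancelˡ Δ-counitʳ) ○ coalg-ε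

    Δ^-counitˡ : ℓ A ∘ ((e^ ω ⊗₁ id) ∘ Δ^ ω) ≈ id
    Δ^-counitˡ =
        refl⟩∘⟨ ( (⟺ (glue Eq.refl coalg-ε)) ⟩∘⟨refl ○ assoc ○ refl⟩∘⟨ ⟺ Δ-ω ○ pushˡ serialize₂₁)
      ○ extendʳ ℓ-natural ○ refl⟩∘⟨ (refl⟩∘⟨ ⟺ assoc ○ cancelˡ Δ-counitˡ) ○ coalg-ε

    -- `e` is natural and `e K` retracts `mK`, so `e K ∘ !₁ eA ∘ ω` computes to both sides.
    e^-unique : ∀ {eA : A ⇒ K} → !₁ eA ∘ ω ≈ mK ∘ eA → e^ ω ≈ eA
    e^-unique p = ⟺ (pullˡ e-natural) ○ refl⟩∘⟨ p ○ cancelˡ e-mK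

    -- Both sides arise from Δ ∘ !ΔA ∘ ω by projecting one copy of A ⊗ A to its first and the
    -- other to its second factor.
    Δ^-unique : ∀ {ΔA : A ⇒ A ⊗₀ A} {eA : A ⇒ K} →
                ρ A ∘ ((id ⊗₁ eA) ∘ ΔA) ≈ id → ℓ A ∘ ((eA ⊗₁ id) ∘ ΔA) ≈ id →
                !₁ ΔA ∘ ω ≈ m A A ∘ ((ω ⊗₁ ω) ∘ ΔA) → !₁ eA ∘ ω ≈ mK ∘ eA → Δ^ ω ≈ ΔA
    Δ^-unique {ΔA} {eA} counitʳ counitˡ p q =
        ⟺ (refl⟩∘⟨ extendʳ Δ-natural ○ pullˡ (glue
            (assoc ○ refl⟩∘⟨ (assoc ○ refl⟩∘⟨ ε-natural) ○ refl⟩∘⟨ ⟺ assoc ○ cancelˡ counitʳ)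
            (assoc ○ refl⟩∘⟨ (assoc ○ refl⟩∘⟨ ε-natural) ○ refl⟩∘⟨ ⟺ assoc ○ cancelˡ counitˡ)))
      ○ refl⟩∘⟨ (refl⟩∘⟨ p ○ extendʳ Δ-m ○ refl⟩∘⟨ assoc)
      ○ pullˡ (glue (assoc ○ refl⟩∘⟨ (assoc ○ refl⟩∘⟨ ε-monoidal ○ glue identityˡ Eq.refl))
                    (assoc ○ refl⟩∘⟨ (assoc ○ refl⟩∘⟨ ε-monoidal ○ glue Eq.refl identityˡ)) ○ ⊗-homomorphism)
      -- Both inner factors have been sent to `K`, where the interchange is the identity.
      ○ assoc ○ refl⟩∘⟨ (extendʳ (⟺ τ-natural) ○ elimˡ τ-K-K ○ refl⟩∘⟨ pullˡ (⟺ ⊗-homomorphism))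
      ○ refl⟩∘⟨ pullˡ (⟺ ⊗-homomorphism) ○ pullˡ (glue
            (refl⟩∘⟨ (pushˡ (⟺ (glue identityˡ Eq.refl)) ○ (Eq.refl ⟩⊗⟨ ⟺ (e^-unique q)) ⟩∘⟨refl) ○ Δ^-counitʳ)
            (refl⟩∘⟨ (pushˡ (⟺ (glue Eq.refl identityˡ)) ○ (⟺ (e^-unique q) ⟩⊗⟨ Eq.refl) ⟩∘⟨refl) ○ Δ^-counitˡ)
          ○ ⊗-identity) ○ identityˡ

-- Algebras of a comonoidal monad with a distributive law.

module Algebras {o c r} {𝕏 : Category o c r} {M : SymmetricMonoidal 𝕏} (L : MonoidalCoalgebraModality M)
                (T : OverModality.MonadData L) where
  open Category 𝕏
  open SymmetricMonoidal M
  open Chasing 𝕏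
  open Coherence M
  open OverModality L
  open MonadData T

  record IsAlgebra {A : Obj} (a : T₀ A ⇒ A) : Set r where
    field
      alg-assoc : a ∘ μ A ≈ a ∘ T₁ a
      alg-unit : a ∘ η A ≈ id
  open IsAlgebra

  IsHom : ∀ {A B} → T₀ A ⇒ A → T₀ B ⇒ B → A ⇒ B → Set r
  IsHom a b f = f ∘ a ≈ b ∘ T₁ f

  module Comonoidal (isComonoidal : IsSymmetricComonoidalMonad T) where
    open IsSymmetricComonoidalMonad isComonoidal
    open IsMonad isMonad

    infixr 10 _⊠_
    _⊠_ : ∀ {A B} → T₀ A ⇒ A → T₀ B ⇒ B → T₀ (A ⊗₀ B) ⇒ A ⊗₀ B
    a ⊠ b = (a ⊗₁ b) ∘ n _ _

    T-∘ : ∀ {A B C} {f : B ⇒ C} {g : A ⇒ B} {h : A ⇒ C} → f ∘ g ≈ h → T₁ f ∘ T₁ g ≈ T₁ h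
    T-∘ p = ⟺ T-homomorphism ○ T-resp-≈ p

    T-square : ∀ {A B C D} {f : B ⇒ D} {g : A ⇒ B} {h : C ⇒ D} {k : A ⇒ C} →
               f ∘ g ≈ h ∘ k → T₁ f ∘ T₁ g ≈ T₁ h ∘ T₁ k
    T-square p = T-∘ p ○ T-homomorphism

    n-natural₁ : ∀ {A B C} {f : A ⇒ B} → n B C ∘ T₁ (f ⊗₁ id) ≈ (T₁ f ⊗₁ id) ∘ n A C
    n-natural₁ = n-natural ○ (Eq.refl ⟩⊗⟨ T-identity) ⟩∘⟨refl

    n-natural₂ : ∀ {A B C} {f : A ⇒ B} → n C B ∘ T₁ (id ⊗₁ f) ≈ (id ⊗₁ T₁ f) ∘ n C A
    n-natural₂ = n-natural ○ (T-identity ⟩⊗⟨ Eq.refl) ⟩∘⟨refl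

    ⊠-isAlgebra : ∀ {A B} {a : T₀ A ⇒ A} {b : T₀ B ⇒ B} → IsAlgebra a → IsAlgebra b → IsAlgebra (a ⊠ b)
    ⊠-isAlgebra p q = record
      { alg-assoc = assoc ○ refl⟩∘⟨ μ-comonoidal ○ extendʳ (glue-squares (alg-assoc p) (alg-assoc q))
          ○ refl⟩∘⟨ (extendʳ (⟺ n-natural) ○ refl⟩∘⟨ ⟺ T-homomorphism) ○ ⟺ assoc
      ; alg-unit = assoc ○ refl⟩∘⟨ η-comonoidal ○ glue (alg-unit p) (alg-unit q) ○ ⊗-identity
      }

    nK-isAlgebra : IsAlgebra nK
    nK-isAlgebra = record { alg-assoc = μ-comonoidalK ; alg-unit = η-comonoidalK }

    inverse-isHom : ∀ {A B} {a : T₀ A ⇒ A} {b : T₀ B ⇒ B} {f : A ⇒ B} {g : B ⇒ A} →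
                    g ∘ f ≈ id → f ∘ g ≈ id → IsHom a b f → IsHom b a g
    inverse-isHom p q h = flip-square (T-∘ q ○ T-identity) p (⟺ h)

    ⊗-isHom : ∀ {A B C D} {a : T₀ A ⇒ A} {b : T₀ B ⇒ B} {c : T₀ C ⇒ C} {d : T₀ D ⇒ D} {f : A ⇒ B} {g : C ⇒ D} →
              IsHom a b f → IsHom c d g → IsHom (a ⊠ c) (b ⊠ d) (f ⊗₁ g)
    ⊗-isHom p q = extendʳ (glue-squares p q) ○ refl⟩∘⟨ ⟺ n-natural ○ ⟺ assoc

    α-isHom : ∀ {A B C} {a : T₀ A ⇒ A} {b : T₀ B ⇒ B} {c : T₀ C ⇒ C} →
              IsHom (a ⊠ (b ⊠ c)) ((a ⊠ b) ⊠ c) (α A B C)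
    α-isHom = refl⟩∘⟨ pushˡ (⟺ (glue identityʳ Eq.refl)) ○ extendʳ α-natural ○ refl⟩∘⟨ n-assoc
      ○ pullˡ (glue Eq.refl identityʳ) ○ ⟺ assoc

    ℓ-isHom : ∀ {A} {a : T₀ A ⇒ A} → IsHom (nK ⊠ a) a (ℓ A)
    ℓ-isHom = refl⟩∘⟨ pushˡ serialize₂₁ ○ extendʳ ℓ-natural ○ refl⟩∘⟨ n-unitˡ

    ρ-isHom : ∀ {A} {a : T₀ A ⇒ A} → IsHom (a ⊠ nK) a (ρ A)
    ρ-isHom = refl⟩∘⟨ pushˡ serialize₁₂ ○ extendʳ ρ-natural ○ refl⟩∘⟨ n-unitʳ

    σ-isHom : ∀ {A B} {a : T₀ A ⇒ A} {b : T₀ B ⇒ B} → IsHom (a ⊠ b) (b ⊠ a) (σ A B)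
    σ-isHom = extendʳ σ-natural ○ refl⟩∘⟨ n-symmetric ○ ⟺ assoc

    open MonoidalCoalgebraModality L

    module LiftedModality {ld : ∀ A → T₀ (!₀ A) ⇒ !₀ (T₀ A)}
                          (isLaw : IsSymMonoidalMixedDistributiveLaw T ld) where
      open Modality L
      open IsSymMonoidalMixedDistributiveLaw isLaw

      !ₐ : ∀ {A} → T₀ A ⇒ A → T₀ (!₀ A) ⇒ !₀ A
      !ₐ a = !₁ a ∘ ld _

      !ₐ-isAlgebra : ∀ {A} {a : T₀ A ⇒ A} → IsAlgebra a → IsAlgebra (!ₐ a)
      !ₐ-isAlgebra p = record
        { alg-assoc = assoc ○ refl⟩∘⟨ ld-μ ○ extendʳ (!-square (alg-assoc p))
            ○ refl⟩∘⟨ (extendʳ (⟺ ld-natural) ○ refl⟩∘⟨ ⟺ T-homomorphism) ○ ⟺ assoc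
        ; alg-unit = assoc ○ refl⟩∘⟨ ld-η ○ !-∘ (alg-unit p) ○ !-identity
        }

      !₁-isHom : ∀ {A B} {a : T₀ A ⇒ A} {b : T₀ B ⇒ B} {f : A ⇒ B} → IsHom a b f → IsHom (!ₐ a) (!ₐ b) (!₁ f)
      !₁-isHom p = extendʳ (!-square p) ○ refl⟩∘⟨ ⟺ ld-natural ○ ⟺ assoc

      δ-isHom : ∀ {A} {a : T₀ A ⇒ A} → IsHom (!ₐ a) (!ₐ (!ₐ a)) (δ A)
      δ-isHom = extendʳ δ-natural ○ refl⟩∘⟨ ld-δ ○ pullˡ (⟺ !-homomorphism) ○ ⟺ assoc

      ε-isHom : ∀ {A} {a : T₀ A ⇒ A} → IsHom (!ₐ a) a (ε A)
      ε-isHom = extendʳ ε-natural ○ refl⟩∘⟨ ld-ε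

      m-isHom : ∀ {A B} {a : T₀ A ⇒ A} {b : T₀ B ⇒ B} → IsHom (!ₐ a ⊠ !ₐ b) (!ₐ (a ⊠ b)) (m A B)
      m-isHom = refl⟩∘⟨ pushˡ ⊗-homomorphism ○ extendʳ m-natural ○ refl⟩∘⟨ ⟺ ld-m
        ○ pullˡ (⟺ !-homomorphism) ○ ⟺ assoc

      mK-isHom : IsHom nK (!ₐ nK) mK
      mK-isHom = ⟺ ld-mK ○ ⟺ assoc

      -- Compatibility of `ld` with `Δ` enters as a hypothesis; for the law of a group it is
      -- supplied by `law-Δ`.
      Δ-isHom : ∀ {A} {a : T₀ A ⇒ A} → Δ (T₀ A) ∘ ld A ≈ (ld A ⊗₁ ld A) ∘ (n _ _ ∘ T₁ (Δ A)) →
                IsHom (!ₐ a) (!ₐ a ⊠ !ₐ a) (Δ A)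
      Δ-isHom ld-Δ = extendʳ Δ-natural ○ refl⟩∘⟨ ld-Δ ○ pullˡ (⟺ ⊗-homomorphism) ○ ⟺ assoc

      e-isHom : ∀ {A} {a : T₀ A ⇒ A} → e (T₀ A) ∘ ld A ≈ nK ∘ T₁ (e A) → IsHom (!ₐ a) nK (e A)
      e-isHom ld-e = pullˡ e-natural ○ ld-e

  -- Closed structure on the algebras of a Hopf monad.

  module Hopf (C : Closed M) (isHopf : IsSymmetricHopfMonad T) where
    open IsSymmetricHopfMonad isHopf
    open IsSymmetricComonoidalMonad isSymComonoidalMonad
    open IsMonad isMonad
    open Comonoidal isSymComonoidalMonad
    open Closed C using ([_,_]; ev; curry; curry-resp-≈; β) renaming (η to curry-ev)

    fusion : ∀ X A → T₀ (X ⊗₀ T₀ A) ⇒ T₀ X ⊗₀ T₀ A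
    fusion X A = (id ⊗₁ μ A) ∘ n X (T₀ A)

    -- Stated for every homomorphism `h` of free algebras, since inverting the fusion map of an
    -- algebra uses `μ` as `h` besides `T₁ a`.
    fusion-natural : ∀ {X A B} {h : T₀ A ⇒ T₀ B} → μ B ∘ T₁ h ≈ h ∘ μ A →
                     fusion X B ∘ T₁ (id ⊗₁ h) ≈ (id ⊗₁ h) ∘ fusion X A
    fusion-natural p = assoc ○ refl⟩∘⟨ n-natural₂ ○ extendʳ (square₂ p)

    fusion⁻¹ : ∀ X A → T₀ X ⊗₀ T₀ A ⇒ T₀ (X ⊗₀ T₀ A)
    fusion⁻¹ X A = proj₁ (fusionˡ-iso {X} {A})

    fusion⁻¹-natural : ∀ {X A B} {h : T₀ A ⇒ T₀ B} → μ B ∘ T₁ h ≈ h ∘ μ A →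
                       fusion⁻¹ X B ∘ (id ⊗₁ h) ≈ T₁ (id ⊗₁ h) ∘ fusion⁻¹ X A
    fusion⁻¹-natural p = flip-square (proj₂ (proj₂ fusionˡ-iso)) (proj₁ (proj₂ fusionˡ-iso)) (⟺ (fusion-natural p))

    -- The fusion operators are those of the free algebras; the fusion map of an algebra is a
    -- retract of the one of its underlying object.
    algebra-fusion-iso : ∀ {X A} {a : T₀ A ⇒ A} → IsAlgebra a → IsIso ((id ⊗₁ a) ∘ n X A)
    algebra-fusion-iso {X} {A} {a} p =
        T₁ (id ⊗₁ a) ∘ (fusion⁻¹ X A ∘ (id ⊗₁ η A))
      , ( assoc ○ refl⟩∘⟨ (assoc ○ refl⟩∘⟨ extendʳ (square₂ η-natural)
            ○ extendʳ (fusion⁻¹-natural μ-natural))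
        ○ extendʳ (T-square (square₂ (⟺ (alg-assoc p))))
        ○ refl⟩∘⟨ ( extendʳ (⟺ (fusion⁻¹-natural monad-assoc))
                  ○ refl⟩∘⟨ (cancelˡ (⊗-iso₂ monad-idˡ)
                    ○ ⟺ (assoc ○ refl⟩∘⟨ n-natural₂ ○ cancelˡ (⊗-iso₂ monad-idʳ)))
                  ○ cancelˡ (proj₁ (proj₂ fusionˡ-iso)))
        ○ T-∘ (⊗-iso₂ (alg-unit p)) ○ T-identity )
      , ( assoc ○ refl⟩∘⟨ extendʳ n-natural₂ ○ extendʳ (square₂ (⟺ (alg-assoc p)))
        ○ refl⟩∘⟨ (⟺ assoc ○ cancelˡ (proj₂ (proj₂ fusionˡ-iso))) ○ ⊗-iso₂ (alg-unit p) )

    module _ {A B} {a : T₀ A ⇒ A} {b : T₀ B ⇒ B} (p : IsAlgebra a) (q : IsAlgebra b) where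
      private
        F : ∀ X → T₀ (X ⊗₀ A) ⇒ T₀ X ⊗₀ A
        F X = (id ⊗₁ a) ∘ n X A

        F⁻¹ : ∀ X → T₀ X ⊗₀ A ⇒ T₀ (X ⊗₀ A)
        F⁻¹ X = proj₁ (algebra-fusion-iso p)

        F-F⁻¹ : ∀ {X} → F X ∘ F⁻¹ X ≈ id
        F-F⁻¹ = proj₂ (proj₂ (algebra-fusion-iso p))

        F⁻¹-F : ∀ {X} → F⁻¹ X ∘ F X ≈ id
        F⁻¹-F = proj₁ (proj₂ (algebra-fusion-iso p))

        F-⊗ : ∀ {X Y} {g : T₀ X ⇒ Y} → (g ⊗₁ id) ∘ F X ≈ (g ⊗₁ a) ∘ n X A
        F-⊗ = pullˡ (⟺ serialize₁₂)

      ev-injective : ∀ {X} {g h : X ⇒ [ A , B ]} → ev A B ∘ (g ⊗₁ id) ≈ ev A B ∘ (h ⊗₁ id) → g ≈ h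
      ev-injective s = ⟺ curry-ev ○ curry-resp-≈ s ○ curry-ev

      -- `F X` is invertible, so a map from `T₀ X` into the internal hom can be tested by evaluating
      -- it on `T₀ (X ⊗₀ A)`.
      ev-T-injective : ∀ {X} {g h : T₀ X ⇒ [ A , B ]} →
                       ev A B ∘ ((g ⊗₁ a) ∘ n X A) ≈ ev A B ∘ ((h ⊗₁ a) ∘ n X A) → g ≈ h
      ev-T-injective s = ev-injective (cancel-epi (F _) (F⁻¹ _) F-F⁻¹
        (assoc ○ refl⟩∘⟨ F-⊗ ○ s ○ ⟺ (assoc ○ refl⟩∘⟨ F-⊗)))

      -- The transpose forced by asking that `ev` be a homomorphism: `F⁻¹` undoes the fusion map,
      -- then `T₁ (ev A B)` and `b` act.
      homAct : T₀ [ A , B ] ⇒ [ A , B ]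
      homAct = curry (b ∘ (T₁ (ev A B) ∘ F⁻¹ [ A , B ]))

      ev-isHom : IsHom (homAct ⊠ a) b (ev A B)
      ev-isHom = refl⟩∘⟨ ⟺ F-⊗ ○ pullˡ β ○ assoc ○ refl⟩∘⟨ (assoc ○ elimʳ F⁻¹-F)

      -- Under `ev-T-injective` both sides become `b ∘ T₁ f`.
      curry-isHom : ∀ {X} {x : T₀ X ⇒ X} {f : X ⊗₀ A ⇒ B} → IsHom (x ⊠ a) b f → IsHom x homAct (curry f)
      curry-isHom s = ev-T-injective
        ( refl⟩∘⟨ pushˡ (⟺ (glue Eq.refl identityˡ)) ○ pullˡ β ○ s
        ○ ⟺ ( refl⟩∘⟨ (pushˡ (⟺ (glue Eq.refl identityʳ)) ○ refl⟩∘⟨ ⟺ n-natural₁ ○ ⟺ assoc)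
            ○ pullˡ ev-isHom ○ assoc ○ refl⟩∘⟨ T-∘ β))

      homAct-isAlgebra : IsAlgebra homAct
      homAct-isAlgebra = record
        -- Two layers of `T₀` call for two fusion maps: `ev-T-injective` handles the outer one, and
        -- `T₁ (F _)` is cancelled for the inner. Both sides become `b ∘ T₁ b ∘ T₁ (T₁ (ev A B))`.
        { alg-assoc = ev-T-injective (cancel-epi (T₁ (F _)) (T₁ (F⁻¹ _)) (T-∘ F-F⁻¹ ○ T-identity)
            ( assoc ○ refl⟩∘⟨ (assoc ○ refl⟩∘⟨ (refl⟩∘⟨ T-homomorphism ○ extendʳ n-natural₂)
                ○ pullˡ (glue identityʳ (⟺ (alg-assoc p)) ○ ⊗-homomorphism) ○ assoc
                ○ refl⟩∘⟨ ⟺ μ-comonoidal ○ ⟺ assoc)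
            ○ pullˡ ev-isHom ○ assoc ○ refl⟩∘⟨ ⟺ μ-natural ○ extendʳ (alg-assoc q)
            ○ ⟺ ( assoc
                ○ refl⟩∘⟨ ( assoc ○ pushˡ (⟺ (glue Eq.refl identityʳ))
                          ○ refl⟩∘⟨ (extendʳ (⟺ n-natural₁) ○ refl⟩∘⟨ T-∘ F-⊗) ○ ⟺ assoc)
                ○ pullˡ ev-isHom ○ assoc ○ refl⟩∘⟨ T-square ev-isHom)))
        ; alg-unit = ev-injective
            -- The identity of `A` is written as `a ∘ η A`, so that `η-comonoidal` applies.
            ( refl⟩∘⟨ (⟺ (glue Eq.refl (alg-unit p)) ○ refl⟩∘⟨ ⟺ η-comonoidal ○ ⟺ assoc)
            ○ pullˡ ev-isHom ○ assoc ○ refl⟩∘⟨ ⟺ η-natural ○ cancelˡ (alg-unit q)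
            ○ ⟺ (elimʳ ⊗-identity))
        }

-- Groups of coalgebras and distributive laws.

module Correspondence {o c r} {𝕏 : Category o c r} {M : SymmetricMonoidal 𝕏} (L : MonoidalCoalgebraModality M) where
  open Category 𝕏
  open SymmetricMonoidal M
  open MonoidalCoalgebraModality L
  open MonoidalNotions M
  open OverModality L
  open Chasing 𝕏
  open Coherence M
  open Modality L
  open TensorMonad L

  coaction : ∀ {H} → (∀ X → H ⊗₀ !₀ X ⇒ !₀ (H ⊗₀ X)) → H ⇒ !₀ H
  coaction {H} ld = !₁ (ρ H) ∘ (ld K ∘ ((id ⊗₁ mK) ∘ ρ⁻¹ H))

  coaction-law : ∀ {H} {ω : H ⇒ !₀ H} → coaction (λ X → m H X ∘ (ω ⊗₁ id)) ≈ ω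
  coaction-law = refl⟩∘⟨ (assoc ○ refl⟩∘⟨ (extendʳ slide ○ refl⟩∘⟨ ⟺ ρ⁻¹-natural) ○ ⟺ assoc)
    ○ pullˡ m-unitʳ ○ cancelˡ ρ-isoʳ

  module _ {H : Obj} {∇ : H ⊗₀ H ⇒ H} {u : K ⇒ H} {S : H ⇒ H} where

    -- Carries the Hopf structure of (`ΔH`, `eH`) over to (`Δ^ ω`, `e^ ω`) once the two comonoids
    -- are known to agree.
    IsHopfMonoid-resp-≈ : ∀ {Δ₁ Δ₂ : H ⇒ H ⊗₀ H} {ϵ₁ ϵ₂ : H ⇒ K} → Δ₁ ≈ Δ₂ → ϵ₁ ≈ ϵ₂ →
                          IsHopfMonoid H ∇ u Δ₂ ϵ₂ S → IsHopfMonoid H ∇ u Δ₁ ϵ₁ S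
    IsHopfMonoid-resp-≈ p q hopf = record
      { isBimonoid = record
        { isMonoid = isMonoid
        ; isComonoid = record
          { Δ-coassoc = refl⟩∘⟨ ((Eq.refl ⟩⊗⟨ p) ⟩∘⟨ p) ○ IsComonoidObj.Δ-coassoc isComonoid
              ○ ⟺ ((p ⟩⊗⟨ Eq.refl) ⟩∘⟨ p)
          ; Δ-counitˡ = refl⟩∘⟨ ((q ⟩⊗⟨ Eq.refl) ⟩∘⟨ p) ○ IsComonoidObj.Δ-counitˡ isComonoid
          ; Δ-counitʳ = refl⟩∘⟨ ((Eq.refl ⟩⊗⟨ q) ⟩∘⟨ p) ○ IsComonoidObj.Δ-counitʳ isComonoid
          }
        ; Δ-∇ = p ⟩∘⟨refl ○ Δ-∇ ○ refl⟩∘⟨ refl⟩∘⟨ ⟺ (p ⟩⊗⟨ p)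
        ; ϵ-∇ = q ⟩∘⟨refl ○ ϵ-∇ ○ refl⟩∘⟨ ⟺ (q ⟩⊗⟨ q)
        ; Δ-u = p ⟩∘⟨refl ○ Δ-u
        ; ϵ-u = q ⟩∘⟨refl ○ ϵ-u
        }
      ; antipodeˡ = refl⟩∘⟨ refl⟩∘⟨ p ○ antipodeˡ ○ refl⟩∘⟨ ⟺ q
      ; antipodeʳ = refl⟩∘⟨ refl⟩∘⟨ p ○ antipodeʳ ○ refl⟩∘⟨ ⟺ q
      }
      where
      open IsHopfMonoid hopf
      open IsBimonoid isBimonoid

    -- From a group to a lifting monad.

    module FromGroup {ω : H ⇒ !₀ H} (isGroup : IsGroupInCoalgebras H ∇ u S ω) where
      open IsGroupInCoalgebras isGroup
      open IsCoalgebra coalgebra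
      open Coalgebra coalgebra

      T : MonadData
      T = tensorMonad H ∇ u (Δ^ ω) (e^ ω)

      open MonadData T using (n; nK; T₁)

      law : ∀ X → H ⊗₀ !₀ X ⇒ !₀ (H ⊗₀ X)
      law X = m H X ∘ (ω ⊗₁ id)

      isCocommHopf : IsCocommutativeHopfMonoid H ∇ u (Δ^ ω) (e^ ω) S
      isCocommHopf = record { isHopfMonoid = hopf ; cocommutative = Δ^-cocommutative }

      law-S : ∀ {X} → law X ∘ (S ⊗₁ id) ≈ !₁ (S ⊗₁ id) ∘ law X
      law-S = assoc ○ refl⟩∘⟨ square₁ S-coalgebra-map ○ extendʳ m-natural₁

      law-α : ∀ {X Y} → !₁ (α H X Y) ∘ (law (X ⊗₀ Y) ∘ (id ⊗₁ m X Y))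
              ≈ m (H ⊗₀ X) Y ∘ ((law X ⊗₁ id) ∘ α H (!₀ X) (!₀ Y))
      law-α = refl⟩∘⟨ (assoc ○ refl⟩∘⟨ slide ○ ⟺ assoc) ○ pullˡ (⟺ m-assoc) ○ assoc
        ○ refl⟩∘⟨ (assoc ○ refl⟩∘⟨ α-natural₁ ○ pullˡ merge₁)

      law-isDistributive : IsSymMonoidalMixedDistributiveLaw T law
      law-isDistributive = record
        { ld-natural = assoc ○ refl⟩∘⟨ slide ○ extendʳ m-natural₂
        ; ld-μ =
              assoc ○ refl⟩∘⟨ (pullˡ (square₁ ∇-coalgebra-map) ○ assoc) ○ extendʳ m-natural₁
            ○ refl⟩∘⟨ (refl⟩∘⟨ (pushˡ (⟺ merge₁) ○ refl⟩∘⟨ ⟺ α-natural ○ ⟺ assoc) ○ pullˡ m-assoc ○ assoc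
                ○ refl⟩∘⟨ (assoc ○ refl⟩∘⟨ (glue identityˡ Eq.refl ○ serialize₁₂) ○ ⟺ assoc))
            ○ pullˡ (⟺ !-homomorphism)
        ; ld-η = assoc ○ refl⟩∘⟨ (pullˡ (square₁ u-coalgebra-map) ○ assoc) ○ extendʳ m-natural₁
            ○ refl⟩∘⟨ m-unitˡ⁻¹ ○ ⟺ !-homomorphism
        ; ld-δ = pullˡ δ-monoidal ○ assoc
            ○ refl⟩∘⟨ (assoc ○ refl⟩∘⟨ (glue coalg-δ identityʳ ○ ⟺ (glue Eq.refl identityˡ)) ○ extendʳ m-natural₁
                ○ refl⟩∘⟨ (refl⟩∘⟨ serialize₁₂ ○ ⟺ assoc))
            ○ pullˡ (⟺ !-homomorphism)
        ; ld-ε = pullˡ ε-monoidal ○ glue coalg-ε identityʳ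
        -- `Δ^-coalgebra-map` turns one coaction into two, and `m-τ` moves the interchange through
        -- `m`.
        ; ld-m =
              pushˡ !-homomorphism
            ○ refl⟩∘⟨ ( refl⟩∘⟨ (assoc ○ refl⟩∘⟨ ⟺ serialize₁₂) ○ extendʳ (⟺ m-natural₁)
                      ○ refl⟩∘⟨ (glue Δ^-coalgebra-map identityˡ ○ ⟺ (glue Eq.refl identityʳ)) ○ ⟺ assoc)
            ○ pullˡ m-τ ○ assoc ○ refl⟩∘⟨ (refl⟩∘⟨ ⟺ merge₁ ○ extendʳ τ-natural₁)
            ○ assoc ○ refl⟩∘⟨ pullˡ (⟺ ⊗-homomorphism)
        ; ld-mK =
              pushˡ !-homomorphism
            ○ refl⟩∘⟨ (refl⟩∘⟨ (assoc ○ refl⟩∘⟨ slide ○ ⟺ assoc) ○ pullˡ m-unitʳ ○ ρ-natural)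
            ○ extendʳ e^-coalgebra-map
        }

      liftingStructure : HopfLiftingStructure H ∇ u S
      liftingStructure = record
        { ΔH = Δ^ ω
        ; eH = e^ ω
        ; ld = law
        ; cocommHopf = isCocommHopf
        ; mellLifting = record
          { isHopfMonad = tensor-isSymmetricHopfMonad isCocommHopf ; isDistributiveLaw = law-isDistributive }
        ; ld-α = law-α
        ; ld-S = law-S
        }

      -- Both `m` and `ω` respect comultiplication, by `Δ-m` and `Δ-ω`.
      law-Δ : ∀ {X} → Δ (H ⊗₀ X) ∘ law X ≈ (law X ⊗₁ law X) ∘ (n (!₀ X) (!₀ X) ∘ T₁ (Δ X))
      law-Δ =
          pullˡ Δ-m ○ assoc
        ○ refl⟩∘⟨ (assoc ○ refl⟩∘⟨ (glue Δ-ω identityʳ ○ ⟺ (glue Eq.refl identityˡ)) ○ extendʳ τ-natural₁)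
        ○ pullˡ (⟺ ⊗-homomorphism) ○ refl⟩∘⟨ (refl⟩∘⟨ serialize₁₂ ○ ⟺ assoc)

      law-e : ∀ {X} → e (H ⊗₀ X) ∘ law X ≈ nK ∘ T₁ (e X)
      law-e = pullˡ e-m ○ assoc ○ ℓ-K≈ρ-K ⟩∘⟨ glue Eq.refl identityʳ
        ○ ⟺ (⟺ ρ-natural ⟩∘⟨refl ○ assoc ○ refl⟩∘⟨ ⟺ serialize₁₂)

    -- From a lifting monad to a group.

    module FromLifting (ℒ : HopfLiftingStructure H ∇ u S) where
      open HopfLiftingStructure ℒ
      open IsCocommutativeHopfMonoid cocommHopf
      open IsHopfMonoid isHopfMonoid
      open IsBimonoid isBimonoid
      open IsMELLLiftingMonad mellLifting
      open IsSymMonoidalMixedDistributiveLaw isDistributiveLaw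

      ω : H ⇒ !₀ H
      ω = coaction ld

      -- `X` is replaced by `K ⊗₀ X`, where `ld-α` pulls `!₀ X` out of the law and leaves `ld K`,
      -- from which `ω` is made.
      ld-coaction : ∀ {X} → m H X ∘ (ω ⊗₁ id) ≈ ld X
      ld-coaction =
          refl⟩∘⟨ ⟺ merge₁ ○ extendʳ m-natural₁
        ○ refl⟩∘⟨ (refl⟩∘⟨ (⟺ merge₁ ○ refl⟩∘⟨ (⟺ merge₁ ○ refl⟩∘⟨ ⟺ triangle⁻¹ ○ extendʳ (⟺ α-natural)) ○ ⟺ assoc)
            ○ pullˡ (⟺ ld-α) ○ assoc ○ refl⟩∘⟨ (assoc ○ refl⟩∘⟨ (refl⟩∘⟨ merge₂ ○ glue₂ m-unitˡ⁻¹) ○ ld-natural))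
        ○ pullˡ (!-∘ triangle) ○ cancelˡ (!-iso (⊗-iso₂ ℓ-isoʳ))

      ω-isCoalgebra : IsCoalgebra H ω
      ω-isCoalgebra = record
        { coalg-δ =
              extendʳ δ-natural
            ○ refl⟩∘⟨ (pullˡ ld-δ ○ assoc ○ refl⟩∘⟨ (assoc ○ refl⟩∘⟨ extendʳ (square₂ δ-monoidalK)
                ○ extendʳ ld-natural))
            ○ ⟺ ( pushˡ !-homomorphism ○ refl⟩∘⟨ (pushˡ !-homomorphism
                ○ refl⟩∘⟨ (pushˡ !-homomorphism ○ refl⟩∘⟨ cancelˡ (!-iso ρ-isoˡ))))
        ; coalg-ε = extendʳ ε-natural ○ refl⟩∘⟨ (pullˡ ld-ε ○ cancelˡ (⊗-iso₂ ε-monoidalK)) ○ ρ-isoʳ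
        }

      open Coalgebra ω-isCoalgebra

      eH-coalgebra-map : !₁ eH ∘ ω ≈ mK ∘ eH
      eH-coalgebra-map = pullˡ (⟺ !-homomorphism) ○ refl⟩∘⟨ ⟺ assoc ○ pullˡ ld-mK ○ assoc
        ○ refl⟩∘⟨ (assoc ○ elimʳ ρ-isoʳ)

      -- Up to unitors `ΔH` is `n K K`, so this is `ld-m` at the unit; `!ℓ⁻¹-mK` splits `mK` in two.
      ΔH-coalgebra-map : !₁ ΔH ∘ ω ≈ m H H ∘ ((ω ⊗₁ ω) ∘ ΔH)
      ΔH-coalgebra-map =
          extendʳ (!-square ΔH-ρ)
        ○ refl⟩∘⟨ ( pushˡ !-homomorphism
                  ○ refl⟩∘⟨ ( extendʳ (⟺ ld-natural)
                            ○ refl⟩∘⟨ (extendʳ (square₂ !ℓ⁻¹-mK) ○ refl⟩∘⟨ pushˡ (⟺ merge₂)) ○ ⟺ assoc)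
                  ○ pullˡ ld-m ○ assoc
                  ○ refl⟩∘⟨ (assoc ○ refl⟩∘⟨ (extendʳ n-natural ○ refl⟩∘⟨ (⟺ assoc ○ ⟺ ΔH-ρ⁻¹))))
        ○ extendʳ (⟺ m-natural)
        ○ refl⟩∘⟨ ⟺ (pushˡ ⊗-homomorphism ○ refl⟩∘⟨ (pushˡ ⊗-homomorphism ○ refl⟩∘⟨ pushˡ ⊗-homomorphism))
        where
        open MonadData (tensorMonad H ∇ u ΔH eH) using (n)
        open IsSymmetricComonoidalMonad (IsSymmetricHopfMonad.isSymComonoidalMonad isHopfMonad) using (n-natural)

        ΔH-ρ : ΔH ∘ ρ H ≈ (ρ H ⊗₁ ρ H) ∘ (n K K ∘ (id ⊗₁ ℓ⁻¹ K))
        ΔH-ρ = ⟺ ( refl⟩∘⟨ (assoc ○ refl⟩∘⟨ slide) ○ extendʳ τ-unitʳ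
                 ○ refl⟩∘⟨ cancelˡ (⊗-iso₂ ℓ-isoʳ) ○ ρ-natural)

        ΔH-ρ⁻¹ : (ρ⁻¹ H ⊗₁ ρ⁻¹ H) ∘ ΔH ≈ (n K K ∘ (id ⊗₁ ℓ⁻¹ K)) ∘ ρ⁻¹ H
        ΔH-ρ⁻¹ = flip-square ρ-isoʳ (glue ρ-isoˡ ρ-isoˡ ○ ⊗-identity) ΔH-ρ

        !ℓ⁻¹-mK : !₁ (ℓ⁻¹ K) ∘ mK ≈ m K K ∘ ((mK ⊗₁ mK) ∘ ℓ⁻¹ K)
        !ℓ⁻¹-mK = pushˡ (⟺ m-unitˡ⁻¹) ○ refl⟩∘⟨ (assoc ○ refl⟩∘⟨ ℓ⁻¹-natural ○ pullˡ (⟺ serialize₁₂))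

      Δ^≈ΔH : Δ^ ω ≈ ΔH
      Δ^≈ΔH = Δ^-unique (IsComonoidObj.Δ-counitʳ isComonoid) (IsComonoidObj.Δ-counitˡ isComonoid)
        ΔH-coalgebra-map eH-coalgebra-map

      e^≈eH : e^ ω ≈ eH
      e^≈eH = e^-unique eH-coalgebra-map

      -- Puts `f ⊗₁ id` to the right of `ld K`. For `f` one of `∇`, `u` and `S`, the laws `ld-μ`,
      -- `ld-η` and `ld-S` can then act.
      ω-∘ : ∀ {X} {f : X ⇒ H} → ω ∘ f ≈ !₁ (ρ H) ∘ (ld K ∘ ((f ⊗₁ id) ∘ ((id ⊗₁ mK) ∘ ρ⁻¹ X)))
      ω-∘ = assoc ○ refl⟩∘⟨ (assoc ○ refl⟩∘⟨ (assoc ○ refl⟩∘⟨ ρ⁻¹-natural ○ extendʳ (⟺ slide)))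

      ω-isGroup : IsGroupInCoalgebras H ∇ u S ω
      ω-isGroup = record
        { coalgebra = ω-isCoalgebra
        -- With the extra unit reassociated, `∇ ⊗₁ id` becomes `μ K`. Then `ld-μ` yields two laws:
        -- the inner one is `ω` by definition, and the outer one gives `ω` through `ld-coaction`.
        ; ∇-coalgebra-map =
              ω-∘
            ○ refl⟩∘⟨ ( refl⟩∘⟨ (refl⟩∘⟨ (refl⟩∘⟨ ⟺ ρ⁻¹-⊗ ○ extendʳ (⟺ α-natural₃) ○ refl⟩∘⟨ merge₂) ○ ⟺ assoc)
                      ○ pullˡ ld-μ ○ assoc ○ refl⟩∘⟨ (assoc ○ refl⟩∘⟨ merge₂))
            ○ extendʳ (!-square (extendʳ ρ-natural ○ refl⟩∘⟨ ρ-⊗))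
            ○ refl⟩∘⟨ ( extendʳ (⟺ ld-natural) ○ refl⟩∘⟨ merge₂
                      ○ ⟺ ld-coaction ⟩∘⟨refl ○ assoc ○ refl⟩∘⟨ ⟺ serialize₁₂)
        ; u-coalgebra-map =
              ω-∘
            ○ refl⟩∘⟨ ( refl⟩∘⟨ (refl⟩∘⟨ (refl⟩∘⟨ ⟺ ℓ⁻¹-K≈ρ⁻¹-K ○ ⟺ ℓ⁻¹-natural) ○ ⟺ assoc)
                      ○ pullˡ ld-η)
            ○ pullˡ (!-∘ (extendʳ ρ-natural ○ elimʳ (⟺ ℓ-K≈ρ-K ⟩∘⟨refl ○ ℓ-isoʳ)))
        ; S-coalgebra-map = ω-∘ ○ refl⟩∘⟨ extendʳ ld-S ○ extendʳ (!-square ρ-natural)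
        ; monoid = isMonoid
        ; hopf = IsHopfMonoid-resp-≈ Δ^≈ΔH e^≈eH isHopfMonoid
        }

  -- The two passages are mutually inverse.

  groups↔liftings : ∀ H ∇ u S → Inverse (GroupStructures H ∇ u S) (HopfLiftingStructures H ∇ u S)
  groups↔liftings H ∇ u S = record
    { to = toLifting
    ; from = fromLifting
    ; to-cong = λ {G} {G′} → to-cong G G′
    ; from-cong = λ {ℒ} {ℒ′} → from-cong ℒ ℒ′
    ; inverse =
        (λ {ℒ} {G} p → trans {toLifting G} {toLifting (fromLifting ℒ)} {ℒ} (to-cong G (fromLifting ℒ) p)
          (FromLifting.Δ^≈ΔH ℒ , FromLifting.e^≈eH ℒ , λ X → FromLifting.ld-coaction ℒ))
      , (λ {G} {ℒ} p → from-cong ℒ (toLifting G) p ○ coaction-law)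
    }
    where
    open Setoid (HopfLiftingStructures H ∇ u S) using (trans) renaming (_≈_ to _≈ₗ_)
    open Setoid (GroupStructures H ∇ u S) using () renaming (Carrier to Group; _≈_ to _≈ᵍ_)

    toLifting : Group → HopfLiftingStructure H ∇ u S
    toLifting (_ , isGroup) = FromGroup.liftingStructure isGroup

    fromLifting : HopfLiftingStructure H ∇ u S → Group
    fromLifting ℒ = FromLifting.ω ℒ , FromLifting.ω-isGroup ℒ

    to-cong : ∀ G G′ → G ≈ᵍ G′ → toLifting G ≈ₗ toLifting G′
    to-cong _ _ p = refl⟩∘⟨ refl⟩∘⟨ p , refl⟩∘⟨ p , λ X → refl⟩∘⟨ p ⟩⊗⟨ Eq.refl

    from-cong : ∀ ℒ ℒ′ → ℒ ≈ₗ ℒ′ → fromLifting ℒ ≈ᵍ fromLifting ℒ′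
    from-cong _ _ (_ , _ , p) = refl⟩∘⟨ p K ⟩∘⟨refl

  -- Modules over a group as a linear category.

  module Linear (C : Closed M) {H : Obj} {∇ : H ⊗₀ H ⇒ H} {u : K ⇒ H} {S : H ⇒ H} {ω : H ⇒ !₀ H}
                (isGroup : IsGroupInCoalgebras H ∇ u S ω) where
    open FromGroup isGroup
    open Modules M H ∇ u
    open Modules.Induced M H ∇ u (Δ^ ω) (e^ ω)
    open Algebras L T
    open Hopf C (tensor-isSymmetricHopfMonad isCocommHopf)
    open Comonoidal (tensor-isSymmetricComonoidalMonad isCocommHopf)
    open LiftedModality law-isDistributive

    -- Modules are the algebras of `H ⊗₀ -`: the laws coincide definitionally and only the records
    -- differ.
    toAlgebra : ∀ {A} {a : H ⊗₀ A ⇒ A} → IsModule A a → IsAlgebra a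
    toAlgebra p = record { alg-assoc = IsModule.act-assoc p ; alg-unit = IsModule.act-unit p }

    fromAlgebra : ∀ {A} {a : H ⊗₀ A ⇒ A} → IsAlgebra a → IsModule A a
    fromAlgebra p = record { act-assoc = IsAlgebra.alg-assoc p ; act-unit = IsAlgebra.alg-unit p }

    alg : (A : Module) → IsAlgebra (act A)
    alg A = toAlgebra (isModule A)

    monoidal : InducedMonoidalStructure
    monoidal = record
        { tensor-isModule = λ A B → fromAlgebra (⊠-isAlgebra (alg A) (alg B))
        ; unit-isModule = fromAlgebra nK-isAlgebra
        }
      , record
        { ⊗₁-equivariant = λ f g → ⊗-isHom (equivariant f) (equivariant g)
        ; α-equivariant = λ _ _ _ → α-isHom
        ; α⁻¹-equivariant = λ _ _ _ → inverse-isHom α-isoˡ α-isoʳ α-isHom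
        ; ℓ-equivariant = λ _ → ℓ-isHom
        ; ℓ⁻¹-equivariant = λ _ → inverse-isHom ℓ-isoˡ ℓ-isoʳ ℓ-isHom
        ; ρ-equivariant = λ _ → ρ-isHom
        ; ρ⁻¹-equivariant = λ _ → inverse-isHom ρ-isoˡ ρ-isoʳ ρ-isHom
        ; σ-equivariant = λ _ _ → σ-isHom
        }

    closed : Closed (MOD-SMC monoidal)
    closed = record
      { [_,_] = λ A B → module[ _ , homAct (alg A) (alg B) , fromAlgebra (homAct-isAlgebra (alg A) (alg B)) ]
      ; ev = λ A B → map[ _ , ev-isHom (alg A) (alg B) ]
      ; curry = λ {_} {A} {B} f → map[ _ , curry-isHom (alg A) (alg B) (equivariant f) ]
      -- Equality in `MOD` is equality of underlying maps, so the equations are those of the given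
      -- closed structure.
      ; curry-resp-≈ = curry-resp-≈
      ; β = β
      ; η = η
      }
      where open Closed C

    modality : MonoidalCoalgebraModality (MOD-SMC monoidal)
    modality = record
      { !₀ = λ A → module[ _ , !ₐ (act A) , fromAlgebra (!ₐ-isAlgebra (alg A)) ]
      ; !₁ = λ f → map[ _ , !₁-isHom (equivariant f) ]
      ; !-identity = !-identity
      ; !-homomorphism = !-homomorphism
      ; !-resp-≈ = !-resp-≈
      ; δ = λ _ → map[ _ , δ-isHom ]
      ; ε = λ _ → map[ _ , ε-isHom ]
      ; δ-natural = δ-natural
      ; ε-natural = ε-natural
      ; comonad-assoc = comonad-assoc
      ; comonad-idˡ = comonad-idˡ
      ; comonad-idʳ = comonad-idʳ
      ; m = λ _ _ → map[ _ , m-isHom ]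
      ; mK = map[ _ , mK-isHom ]
      ; m-natural = m-natural
      ; m-assoc = m-assoc
      ; m-unitˡ = m-unitˡ
      ; m-unitʳ = m-unitʳ
      ; m-symmetric = m-symmetric
      ; δ-monoidal = δ-monoidal
      ; δ-monoidalK = δ-monoidalK
      ; ε-monoidal = ε-monoidal
      ; ε-monoidalK = ε-monoidalK
      ; Δ = λ _ → map[ _ , Δ-isHom law-Δ ]
      ; e = λ _ → map[ _ , e-isHom law-e ]
      ; Δ-natural = Δ-natural
      ; e-natural = e-natural
      ; Δ-coassoc = Δ-coassoc
      ; Δ-counitˡ = Δ-counitˡ
      ; Δ-counitʳ = Δ-counitʳ
      ; Δ-cocomm = Δ-cocomm
      ; δ-comonoid-Δ = δ-comonoid-Δ
      ; δ-comonoid-e = δ-comonoid-e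
      ; Δ-m = Δ-m
      ; e-m = e-m
      ; Δ-mK = Δ-mK
      ; e-mK = e-mK
      ; !Δ-δ = !Δ-δ
      ; !e-δ = !e-δ
      }

theorem6p10 :
  ∀ {o c r} {𝕏 : Category o c r} (M : SymmetricMonoidal 𝕏)
    (C : Closed M) (L : MonoidalCoalgebraModality M) →
  let open Category 𝕏
      open SymmetricMonoidal M
      open OverModality L
  in
  -- (1) groups in (𝕏^!, ⊗^m, (K, mK)) with underlying (H, ∇, u, S)
  --     correspond bijectively to (2) structures (Δ^H, e^H, λ) on (H, ∇, u, S)
  ((H : Obj) (∇ : H ⊗₀ H ⇒ H) (u : K ⇒ H) (S : H ⇒ H) →
     Inverse (GroupStructures H ∇ u S) (HopfLiftingStructures H ∇ u S))
  ×
  -- for each group ((H, ω), ∇, u, S), MOD(H, ∇, u) with the monoidal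
  -- structure induced by (Δ^ω, e^ω) is a linear category
  ((H : Obj) (∇ : H ⊗₀ H ⇒ H) (u : K ⇒ H) (S : H ⇒ H)
   (G : Setoid.Carrier (GroupStructures H ∇ u S)) →
     let open Modules.Induced M H ∇ u (Δ^ (proj₁ G)) (e^ (proj₁ G))
     in Σ InducedMonoidalStructure (λ I → LinearStructure (MOD-SMC I)))
theorem6p10 M C L =
    groups↔liftings
  , λ H ∇ u S (ω , isGroup) →
      let open Linear C isGroup in monoidal , record { closed = closed ; modality = modality }
  where open Correspondence L
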